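{- For integers $n,k,i,j\geq 0$, let $A_{i,j}(n,k)$ be the number of alternative tableaux of length $n$ with exactly $k$ rows, $i$ free rows and $j$ free columns. Let $$A(z,u,x,y)=\sum_{n,k,i,j\geq 0}A_{i,j}(n,k)\,x^iy^ju^k\frac{z^n}{n!}.$$ Then $$A(z,u,x,y)=\exp\left(zy(1-u)+(x+y)\ln\left(\frac{1-u}{1-u\exp(z(1-u))}\right)\right).$$
   Context: A shape of length $n$ is a Ferrers diagram in English notation (possibly with empty rows or columns), determined by its south-east border, a path of $n$ unit south/west steps from the top-right to the bottom-left corner. South steps correspond to rows and west steps to columns, so the number of rows plus the number of columns equals $n$. An alternative tableau is a shape with a partial filling of cells by left arrows and up arrows such that every cell to the left of a left arrow in its row, and every cell above an up arrow in its column, is empty. Its length is that of its shape. A free row is a row with no left arrow; a free column is a column with no up arrow. -}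

module Defs where

open import Data.Bool using (Bool; true; false; _∧_; not; if_then_else_)
open import Data.Nat as ℕ using (ℕ; zero; suc; _∸_; _!; _<ᵇ_; _≡ᵇ_)
open import Data.Nat.Properties using (_!≢0)
open import Data.Fin using (Fin; toℕ)
open import Data.Vec using (Vec; []; _∷_; lookup)
open import Data.List as L using (List; []; _∷_; [_]; length; filter; allFin; cartesianProduct; concatMap)
open import Data.Bool.ListAction using (all; any)
open import Data.Product using (_×_; _,_)
open import Data.Integer using (+_; -[1+_])
open import Data.Rational as Q using (ℚ; 0ℚ; 1ℚ; _/_)
open import Relation.Nullary.Decidable using (does)
open import Data.Bool.Properties using () renaming (_≟_ to _≟B_)

-- A shape of length n is its south-east border path of n steps, read
-- from the top-right corner to the bottom-left corner:
--   true  = south step (a row),   false = west step (a column).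
Shape : ℕ → Set
Shape n = Vec Bool n

isRow isCol : ∀ {n} → Shape n → Fin n → Bool
isRow s p = lookup s p
isCol s q = not (lookup s q)

-- Rows are indexed by the positions p of their south steps (top to
-- bottom = increasing p) and columns by the positions q of their west
-- steps (right to left = increasing q).  Cell (row p, column q) belongs
-- to the diagram iff p < q (the row's south step precedes the column's
-- west step along the path).
isCell : ∀ {n} → Shape n → Fin n → Fin n → Bool
isCell s p q = isRow s p ∧ isCol s q ∧ (toℕ p <ᵇ toℕ q)

data Label : Set where
  blank left up : Label

isBlank isLeft isUp : Label → Bool
isBlank blank = true
isBlank _     = false
isLeft left = true
isLeft _    = false
isUp up = true
isUp _  = false

Filling : ℕ → Set
Filling n = Vec (Vec Label n) n

entry : ∀ {n} → Filling n → Fin n → Fin n → Label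
entry F p q = lookup (lookup F p) q

_⇒ᵇ_ : Bool → Bool → Bool
a ⇒ᵇ b = not a Data.Bool.∨ b
  where import Data.Bool

-- Validity of (s , F) as an alternative tableau:
--  * only cells of the diagram may carry an arrow (everything else blank);
--  * for a left arrow at (p,q), every cell to its left in row p, i.e.
--    (p,q') with q' > q, is empty;
--  * for an up arrow at (p,q), every cell above it in column q, i.e.
--    (p',q) with p' < p, is empty.
isAltTableau : ∀ {n} → Shape n → Filling n → Bool
isAltTableau {n} s F =
  all (λ p → all (λ q →
      (not (isBlank (entry F p q)) ⇒ᵇ isCell s p q)
    ∧ (isLeft (entry F p q) ⇒ᵇ
         all (λ q' → (toℕ q <ᵇ toℕ q') ⇒ᵇ isBlank (entry F p q')) (allFin n))
    ∧ (isUp (entry F p q) ⇒ᵇ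
         all (λ p' → (toℕ p' <ᵇ toℕ p) ⇒ᵇ isBlank (entry F p' q)) (allFin n))
    ) (allFin n)) (allFin n)

count : ∀ {n} → (Fin n → Bool) → ℕ
count {n} P = length (filter (λ x → P x ≟B true) (allFin n))

numRows : ∀ {n} → Shape n → ℕ
numRows s = count (isRow s)

numFreeRows : ∀ {n} → Shape n → Filling n → ℕ
numFreeRows {n} s F =
  count (λ p → isRow s p ∧ not (any (λ q → isLeft (entry F p q)) (allFin n)))

numFreeCols : ∀ {n} → Shape n → Filling n → ℕ
numFreeCols {n} s F =
  count (λ q → isCol s q ∧ not (any (λ p → isUp (entry F p q)) (allFin n)))

allVecs : ∀ {A : Set} → List A → (n : ℕ) → List (Vec A n)
allVecs xs zero    = [ [] ]
allVecs xs (suc n) = concatMap (λ x → L.map (x ∷_) (allVecs xs n)) xs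

allShapes : (n : ℕ) → List (Shape n)
allShapes n = allVecs (true ∷ false ∷ []) n

allFillings : (n : ℕ) → List (Filling n)
allFillings n = allVecs (allVecs (blank ∷ left ∷ up ∷ []) n) n

A : ℕ → ℕ → ℕ → ℕ → ℕ
A i j n k = length (filter (λ { (s , F) →
      (isAltTableau s F ∧ (numRows s ≡ᵇ k)
        ∧ (numFreeRows s F ≡ᵇ i) ∧ (numFreeCols s F ≡ᵇ j)) ≟B true })
    (cartesianProduct (allShapes n) (allFillings n)))

-- coefficient of z^n u^k x^i y^j is  f n k i j
PS : Set
PS = ℕ → ℕ → ℕ → ℕ → ℚ

sumTo : ℕ → (ℕ → ℚ) → ℚ
sumTo zero    g = g 0
sumTo (suc N) g = sumTo N g Q.+ g (suc N)

constPS : ℚ → PS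
constPS c 0 0 0 0 = c
constPS c _ _ _ _ = 0ℚ

oneP : PS
oneP = constPS 1ℚ

zP uP xP yP : PS
zP 1 0 0 0 = 1ℚ
zP _ _ _ _ = 0ℚ
uP 0 1 0 0 = 1ℚ
uP _ _ _ _ = 0ℚ
xP 0 0 1 0 = 1ℚ
xP _ _ _ _ = 0ℚ
yP 0 0 0 1 = 1ℚ
yP _ _ _ _ = 0ℚ

infixl 6 _⊕_ _⊖_
infixl 7 _⊗_ _·_

_⊕_ _⊖_ _⊗_ : PS → PS → PS
(f ⊕ g) n k i j = f n k i j Q.+ g n k i j
(f ⊖ g) n k i j = f n k i j Q.- g n k i j
(f ⊗ g) n k i j =
  sumTo n λ a → sumTo k λ b → sumTo i λ c → sumTo j λ d →
    f a b c d Q.* g (n ∸ a) (k ∸ b) (i ∸ c) (j ∸ d)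

_·_ : ℚ → PS → PS
(c · f) n k i j = c Q.* f n k i j

_^P_ : PS → ℕ → PS
f ^P zero  = oneP
f ^P suc m = f ⊗ (f ^P m)

invFact : ℕ → ℚ
invFact m = (+ 1) / (m !)
  where instance _ = m !≢0

logCoeff : ℕ → ℚ
logCoeff zero = 0ℚ
logCoeff (suc m) = (if even m then + 1 else -[1+ 0 ]) / suc m
  where
    even : ℕ → Bool
    even zero = true
    even (suc zero) = false
    even (suc (suc t)) = even t

-- The series below are only used with the stated hypotheses on their
-- constant terms; then the sums are exact, because the relevant power of
-- a series with zero constant term has total degree ≥ the exponent, so
-- only exponents m ≤ n+k+i+j contribute to the coefficient at (n,k,i,j).

-- exp f = Σ_{m≥0} f^m / m!          (for f with zero constant term)
expP : PS → PS
expP f n k i j = sumTo (n ℕ.+ k ℕ.+ i ℕ.+ j) λ m → invFact m Q.* (f ^P m) n k i j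

-- ln h = Σ_{m≥1} (-1)^(m+1) (h-1)^m / m     (for h with constant term 1)
lnP : PS → PS
lnP h n k i j = sumTo (n ℕ.+ k ℕ.+ i ℕ.+ j) λ m → logCoeff m Q.* ((h ⊖ oneP) ^P m) n k i j

-- 1/h = Σ_{m≥0} (1-h)^m              (for h with constant term 1)
invP : PS → PS
invP h n k i j = sumTo (n ℕ.+ k ℕ.+ i ℕ.+ j) λ m → ((oneP ⊖ h) ^P m) n k i j

genA : PS
genA n k i j = (+ A i j n k) / (n !)
  where instance _ = n !≢0

rhsA : PS
rhsA = expP (zP ⊗ yP ⊗ (oneP ⊖ uP)
             ⊕ (xP ⊕ yP) ⊗ lnP ((oneP ⊖ uP) ⊗ invP (oneP ⊖ uP ⊗ expP (zP ⊗ (oneP ⊖ uP)))))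

-- Prepending a step to the border of a tableau gives a new rightmost column without cells (west step)
-- or a new top row (south step).  In the new row only the free columns are open: without a left arrow
-- each open cell is blank or gets an up arrow, and a left arrow leaves everything to its left blank.
-- So, writing P n for the polynomial counting tableaux of length n,
--   P (n + 1) (y) = y (1 - u) P n (y) + u (x + y) P n (y + 1).
-- Let F be the right-hand side, E = exp (z (1 - u)) and h the argument of its logarithm.  Since
-- z ∂h/∂z = z u E h², one gets z ∂F/∂z = z (y (1 - u) + (x + y) u E h) F.  Moreover y ∂F/∂y = y α F
-- with α = z (1 - u) + ln h free of y, so Taylor's formula turns y ↦ y + 1 into multiplication by
-- exp α = E h.  Hence F satisfies the same recurrence in z, which determines it.
{-# OPTIONS --safe #-}
module Submission where

-- Derivatives appear as Euler operators, which multiply each coefficient by a weight of its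
-- exponent. A weight that adds up under products gives a derivation with no index shift, so one set
-- of rules serves three weights. The z-degree yields the recurrence for F. The y-degree yields
-- Taylor's formula. The total degree yields exp α = E h: a series that it annihilates is constant,
-- so exp (ln h) never has to be composed. The obstacle is that exp, ln and 1/h are sums cut off at
-- a degree that varies with the coefficient. The cutoff is harmless for arguments of order at least
-- one. For ln h this comes from h - 1 being divisible by z, which becomes visible after dividing by
-- the unit 1 - u. On the counting side the recurrence is proved over the naturals for arbitrary
-- weights of the three statistics; the term - u y P (n) is therefore added on the left and moved
-- back only over the rationals.

open import Algebra.Bundles using (CommutativeRing)
import Algebra.Properties.Group as GroupProperties
import Algebra.Solver.Ring.NaturalCoefficients.Default as NatSolver

-- Derivations on a commutative ring.

module DifferentialRing {c ℓ} (R : CommutativeRing c ℓ) where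

  open CommutativeRing R

  module Rules
    (D : Carrier → Carrier)
    (D-cong : ∀ {a b} → a ≈ b → D a ≈ D b)
    (D-+ : ∀ a b → D (a + b) ≈ D a + D b)
    (D-* : ∀ a b → D (a * b) ≈ D a * b + a * D b)
    where

    open import Relation.Binary.Reasoning.Setoid setoid
    open NatSolver commutativeSemiring
    open GroupProperties +-group using () renaming (∙-cancelʳ to +-cancelʳ; ∙-cancelˡ to +-cancelˡ)

    D-1 : D 1# ≈ 0#
    D-1 = +-cancelʳ (D 1#) (D 1#) 0# (begin
      D 1# + D 1#               ≈⟨ solve 1 (λ a → a :+ a := a :* con 1 :+ con 1 :* a) refl (D 1#) ⟩
      D 1# * 1# + 1# * D 1#     ≈⟨ D-* 1# 1# ⟨
      D (1# * 1#)               ≈⟨ D-cong (*-identityˡ 1#) ⟩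
      D 1#                      ≈⟨ +-identityˡ (D 1#) ⟨
      0# + D 1#                 ∎)

    -- Subtraction is expressed by complements, 1 - u being a `v` with `v + u ≈ 1#`, because the
    -- solver in use knows only the semiring operations.
    D-complement : ∀ {a b} → a + b ≈ 1# → D a + D b ≈ 0#
    D-complement {a} {b} a+b≈1 = trans (sym (D-+ a b)) (trans (D-cong a+b≈1) D-1)

    D-constant-complement : ∀ {a b} → a + b ≈ 1# → D b ≈ 0# → D a ≈ 0#
    D-constant-complement {a} {b} a+b≈1 Db≈0 = begin
      D a        ≈⟨ +-identityʳ (D a) ⟨
      D a + 0#   ≈⟨ +-congˡ Db≈0 ⟨
      D a + D b  ≈⟨ D-complement a+b≈1 ⟩
      0#         ∎

    -- Differentiating `q * I ≈ 1#` gives q D I = - I D q = I D t; multiplying by `I` removes `q`.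
    D-inverse : ∀ {q t I} → q + t ≈ 1# → q * I ≈ 1# → D I ≈ I * I * D t
    D-inverse {q} {t} {I} q+t≈1 qI≈1 = begin
      D I               ≈⟨ *-identityˡ (D I) ⟨
      1# * D I          ≈⟨ *-congʳ qI≈1 ⟨
      q * I * D I       ≈⟨ solve 3 (λ q I d → q :* I :* d := I :* (q :* d)) refl q I (D I) ⟩
      I * (q * D I)     ≈⟨ *-congˡ qDI ⟩
      I * (D t * I)     ≈⟨ solve 2 (λ I d → I :* (d :* I) := I :* I :* d) refl I (D t) ⟩
      I * I * D t       ∎
      where
      qDI : q * D I ≈ D t * I
      qDI = +-cancelˡ (D q * I) (q * D I) (D t * I) (begin
        D q * I + q * D I  ≈⟨ D-* q I ⟨
        D (q * I)          ≈⟨ D-cong qI≈1 ⟩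
        D 1#               ≈⟨ D-1 ⟩
        0#                 ≈⟨ zeroˡ I ⟨
        0# * I             ≈⟨ *-congʳ (D-complement q+t≈1) ⟨
        (D q + D t) * I    ≈⟨ distribʳ I (D q) (D t) ⟩
        D q * I + D t * I  ∎)

    D-constant-*ˡ : ∀ {a} b → D a ≈ 0# → D (a * b) ≈ a * D b
    D-constant-*ˡ {a} b Da≈0 = begin
      D (a * b)          ≈⟨ D-* a b ⟩
      D a * b + a * D b  ≈⟨ +-congʳ (trans (*-congʳ Da≈0) (zeroˡ b)) ⟩
      0# + a * D b       ≈⟨ +-identityˡ _ ⟩
      a * D b            ∎

    D-constant-*ʳ : ∀ a {b} → D b ≈ 0# → D (a * b) ≈ D a * b
    D-constant-*ʳ a {b} Db≈0 = begin
      D (a * b)          ≈⟨ D-* a b ⟩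
      D a * b + a * D b  ≈⟨ +-congˡ (trans (*-congˡ Db≈0) (zeroʳ a)) ⟩
      D a * b + 0#       ≈⟨ +-identityʳ _ ⟩
      D a * b            ∎

    D-constant-* : ∀ {a b} → D a ≈ 0# → D b ≈ 0# → D (a * b) ≈ 0#
    D-constant-* {a} {b} Da≈0 Db≈0 = trans (D-constant-*ˡ b Da≈0) (trans (*-congˡ Db≈0) (zeroʳ a))

    D-constant-+ : ∀ {a b} → D a ≈ 0# → D b ≈ 0# → D (a + b) ≈ 0#
    D-constant-+ {a} {b} Da≈0 Db≈0 = trans (D-+ a b) (trans (+-cong Da≈0 Db≈0) (+-identityˡ 0#))

    unit-cancelʳ : ∀ {a b h s} → h * s ≈ 1# → a * h ≈ b * h → a ≈ b
    unit-cancelʳ {a} {b} {h} {s} hs≈1 ah≈bh = begin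
      a            ≈⟨ unfold a ⟩
      a * h * s    ≈⟨ *-congʳ ah≈bh ⟩
      b * h * s    ≈⟨ unfold b ⟨
      b            ∎
      where
      unfold : ∀ x → x ≈ x * h * s
      unfold x = sym (trans (*-assoc x h s) (trans (*-congˡ hs≈1) (*-identityʳ x)))

    -- The paper's quotient (1 - u) / (1 - u exp e) is v * I.
    module Quotient {u v e E I q}
      (Du≈0 : D u ≈ 0#) (v+u≈1 : v + u ≈ 1#) (DE : D E ≈ D e * E)
      (q+uE≈1 : q + u * E ≈ 1#) (qI≈1 : q * I ≈ 1#) where

      Dv≈0 : D v ≈ 0#
      Dv≈0 = D-constant-complement v+u≈1 Du≈0

      -- The last factor is split off so that `u * I * E * D e` stands as the logarithmic derivative
      -- of the quotient.
      D-quotient : D (v * I) ≈ u * I * E * D e * (v * I)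
      D-quotient = begin
        D (v * I)                    ≈⟨ D-constant-*ˡ I Dv≈0 ⟩
        v * D I                      ≈⟨ *-congˡ (D-inverse q+uE≈1 qI≈1) ⟩
        v * (I * I * D (u * E))      ≈⟨ *-congˡ (*-congˡ (trans (D-constant-*ˡ E Du≈0) (*-congˡ DE))) ⟩
        v * (I * I * (u * (D e * E)))
          ≈⟨ solve 5 (λ v I u d E → v :* (I :* I :* (u :* (d :* E))) := u :* I :* E :* d :* (v :* I)) refl v I u (D e) E ⟩
        u * I * E * D e * (v * I)    ∎

open import Defs
open import Data.Bool using (_∧_; false; true)
open import Data.Bool.Properties using (∧-zeroʳ)
open import Data.Integer as ℤ using (-[1+_])
import Data.Integer.Properties as ℤₚ
open import Data.List using (cartesianProduct)
open import Data.Nat as ℕ using (ℕ; zero; suc; _∸_; _!; _≤_; _<_; z≤n; s≤s; _≡ᵇ_)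
open import Data.Nat.Combinatorics using (_C_; nCk+nC[k+1]≡[n+1]C[k+1]; nCk≡nC[n∸k]; nCn≡1; nC1≡n; k>n⇒nCk≡0)
import Data.Nat.Properties as ℕₚ
open import Data.Nat.Solver using (module +-*-Solver)
open import Data.Product using (_,_)
open import Data.Rational using (ℚ; 0ℚ; 1ℚ; _+_; _*_; -_; _-_; _/_; toℚᵘ)
import Data.Rational.Properties as Qₚ
import Data.Rational.Unnormalised as U
import Data.Rational.Unnormalised.Properties as Uₚ
open import Data.Sum using (inj₁; inj₂)
open import Function using (_∘_)
open import Relation.Binary.PropositionalEquality
open import Relation.Nullary using (yes; no)
import Algebra.Construct.Pointwise as Pointwise
open import Algebra.Properties.Group Qₚ.+-0-group using (⁻¹-involutive)

-- Counting tableaux by removing the first border step.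

module Tableaux where

  open import Data.Bool using (Bool; _∨_; not; if_then_else_)
  open import Data.Bool.ListAction using (all; any)
  open import Data.Bool.Properties using (∧-identityʳ) renaming (_≟_ to _≟B_)
  open import Data.Fin using (Fin; zero; suc; toℕ)
  open import Data.List as L using (List; []; _∷_; _++_; length; filter; tabulate; allFin; concatMap)
  open import Data.Nat using (_<ᵇ_)
  open import Data.Product using (_×_)
  open import Data.Vec as V using (Vec; []; _∷_; lookup)
  open import Data.Vec.Properties using (lookup-map)
  open import Level using (Level)
  open import Relation.Nullary.Decidable using (does)
  open import Relation.Unary using (Pred; Decidable)

  private variable
    X Y : Set
    n m : ℕ

  𝟙 : Bool → ℕ
  𝟙 b = if b then 1 else 0

  𝟙-∧ : ∀ a b → 𝟙 (a ∧ b) ≡ 𝟙 a ℕ.* 𝟙 b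
  𝟙-∧ true  b = sym (ℕₚ.*-identityˡ (𝟙 b))
  𝟙-∧ false b = refl

  ∑ : List X → (X → ℕ) → ℕ
  ∑ []       f = 0
  ∑ (x ∷ xs) f = f x ℕ.+ ∑ xs f

  ∑-cong : ∀ (xs : List X) {f g : X → ℕ} → (∀ x → f x ≡ g x) → ∑ xs f ≡ ∑ xs g
  ∑-cong []       e = refl
  ∑-cong (x ∷ xs) e = cong₂ ℕ._+_ (e x) (∑-cong xs e)

  ∑-0 : ∀ (xs : List X) {f : X → ℕ} → (∀ x → f x ≡ 0) → ∑ xs f ≡ 0
  ∑-0 []       e = refl
  ∑-0 (x ∷ xs) e = cong₂ ℕ._+_ (e x) (∑-0 xs e)

  ∑-+ : ∀ (xs : List X) (f g : X → ℕ) → ∑ xs (λ x → f x ℕ.+ g x) ≡ ∑ xs f ℕ.+ ∑ xs g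
  ∑-+ []       f g = refl
  ∑-+ (x ∷ xs) f g = trans (cong (f x ℕ.+ g x ℕ.+_) (∑-+ xs f g))
    (solve 4 (λ a b c d → (a :+ b) :+ (c :+ d) := (a :+ c) :+ (b :+ d)) refl (f x) (g x) (∑ xs f) (∑ xs g))
    where open +-*-Solver

  ∑-*ˡ : ∀ (xs : List X) c (f : X → ℕ) → ∑ xs (λ x → c ℕ.* f x) ≡ c ℕ.* ∑ xs f
  ∑-*ˡ []       c f = sym (ℕₚ.*-zeroʳ c)
  ∑-*ˡ (x ∷ xs) c f = trans (cong (c ℕ.* f x ℕ.+_) (∑-*ˡ xs c f)) (sym (ℕₚ.*-distribˡ-+ c (f x) _))

  ∑-swap : ∀ (xs : List X) (ys : List Y) (f : X → Y → ℕ) →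
           ∑ xs (λ x → ∑ ys (f x)) ≡ ∑ ys (λ y → ∑ xs (λ x → f x y))
  ∑-swap []       ys f = sym (∑-0 ys λ _ → refl)
  ∑-swap (x ∷ xs) ys f = trans (cong (∑ ys (f x) ℕ.+_) (∑-swap xs ys f)) (sym (∑-+ ys (f x) _))

  ∑-++ : ∀ (xs ys : List X) (f : X → ℕ) → ∑ (xs ++ ys) f ≡ ∑ xs f ℕ.+ ∑ ys f
  ∑-++ []       ys f = refl
  ∑-++ (x ∷ xs) ys f = trans (cong (f x ℕ.+_) (∑-++ xs ys f)) (sym (ℕₚ.+-assoc (f x) _ _))

  ∑-map : ∀ (h : X → Y) (xs : List X) (f : Y → ℕ) → ∑ (L.map h xs) f ≡ ∑ xs (f ∘ h)
  ∑-map h []       f = refl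
  ∑-map h (x ∷ xs) f = cong (f (h x) ℕ.+_) (∑-map h xs f)

  ∑-concatMap : ∀ (h : X → List Y) (xs : List X) (f : Y → ℕ) →
                ∑ (concatMap h xs) f ≡ ∑ xs (λ x → ∑ (h x) f)
  ∑-concatMap h []       f = refl
  ∑-concatMap h (x ∷ xs) f = trans (∑-++ (h x) (concatMap h xs) f) (cong (∑ (h x) f ℕ.+_) (∑-concatMap h xs f))

  ∑-cartesianProduct : ∀ (xs : List X) (ys : List Y) (f : X × Y → ℕ) →
                       ∑ (cartesianProduct xs ys) f ≡ ∑ xs (λ x → ∑ ys (λ y → f (x , y)))
  ∑-cartesianProduct []       ys f = refl
  ∑-cartesianProduct (x ∷ xs) ys f = trans (∑-++ (L.map (x ,_) ys) (cartesianProduct xs ys) f)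
    (cong₂ ℕ._+_ (∑-map (x ,_) ys f) (∑-cartesianProduct xs ys f))

  ∑-allVecs : ∀ (xs : List X) n (f : Vec X (suc n) → ℕ) →
              ∑ (allVecs xs (suc n)) f ≡ ∑ xs (λ x → ∑ (allVecs xs n) (λ v → f (x ∷ v)))
  ∑-allVecs xs n f = trans (∑-concatMap (λ x → L.map (x ∷_) (allVecs xs n)) xs f)
    (∑-cong xs λ x → ∑-map (x ∷_) (allVecs xs n) f)

  length-filter : ∀ {p : Level} {Q : Pred X p} (Q? : Decidable Q) xs →
                  length (filter Q? xs) ≡ ∑ xs (λ x → 𝟙 (does (Q? x)))
  length-filter Q? []       = refl
  length-filter Q? (x ∷ xs) with does (Q? x)
  ... | true  = cong suc (length-filter Q? xs)
  ... | false = length-filter Q? xs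

  does-≟-true : ∀ b → does (b ≟B true) ≡ b
  does-≟-true true  = refl
  does-≟-true false = refl

  -- Counterparts of all, any and count over allFin that compute on Fin (suc n).
  allᶠ anyᶠ : (Fin n → Bool) → Bool
  allᶠ {zero}  P = true
  allᶠ {suc n} P = P zero ∧ allᶠ (P ∘ suc)
  anyᶠ {zero}  P = false
  anyᶠ {suc n} P = P zero ∨ anyᶠ (P ∘ suc)

  countᶠ : (Fin n → Bool) → ℕ
  countᶠ {zero}  P = 0
  countᶠ {suc n} P = 𝟙 (P zero) ℕ.+ countᶠ (P ∘ suc)

  all-tabulate : ∀ (P : X → Bool) (f : Fin n → X) → all P (tabulate f) ≡ allᶠ (P ∘ f)
  all-tabulate {n = zero}  P f = refl
  all-tabulate {n = suc n} P f = cong (P (f zero) ∧_) (all-tabulate P (f ∘ suc))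

  any-tabulate : ∀ (P : X → Bool) (f : Fin n → X) → any P (tabulate f) ≡ anyᶠ (P ∘ f)
  any-tabulate {n = zero}  P f = refl
  any-tabulate {n = suc n} P f = cong (P (f zero) ∨_) (any-tabulate P (f ∘ suc))

  all-allFin : ∀ n (P : Fin n → Bool) → all P (allFin n) ≡ allᶠ P
  all-allFin n P = all-tabulate P (λ x → x)

  any-allFin : ∀ n (P : Fin n → Bool) → any P (allFin n) ≡ anyᶠ P
  any-allFin n P = any-tabulate P (λ x → x)

  ∑-tabulate : ∀ (P : X → Bool) (f : Fin n → X) → ∑ (tabulate f) (λ x → 𝟙 (does (P x ≟B true))) ≡ countᶠ (P ∘ f)
  ∑-tabulate {n = zero}  P f = refl
  ∑-tabulate {n = suc n} P f = cong₂ ℕ._+_ (cong 𝟙 (does-≟-true (P (f zero)))) (∑-tabulate P (f ∘ suc))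

  count≡countᶠ : ∀ (P : Fin n → Bool) → count P ≡ countᶠ P
  count≡countᶠ P = trans (length-filter (λ x → P x ≟B true) (allFin _)) (∑-tabulate P (λ x → x))

  allᶠ-cong : ∀ {P Q : Fin n → Bool} → (∀ x → P x ≡ Q x) → allᶠ P ≡ allᶠ Q
  allᶠ-cong {n = zero}  e = refl
  allᶠ-cong {n = suc n} e = cong₂ _∧_ (e zero) (allᶠ-cong (e ∘ suc))

  anyᶠ-cong : ∀ {P Q : Fin n → Bool} → (∀ x → P x ≡ Q x) → anyᶠ P ≡ anyᶠ Q
  anyᶠ-cong {n = zero}  e = refl
  anyᶠ-cong {n = suc n} e = cong₂ _∨_ (e zero) (anyᶠ-cong (e ∘ suc))

  countᶠ-cong : ∀ {P Q : Fin n → Bool} → (∀ x → P x ≡ Q x) → countᶠ P ≡ countᶠ Q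
  countᶠ-cong {n = zero}  e = refl
  countᶠ-cong {n = suc n} e = cong₂ ℕ._+_ (cong 𝟙 (e zero)) (countᶠ-cong (e ∘ suc))

  allᶠ-true : ∀ {P : Fin n → Bool} → (∀ x → P x ≡ true) → allᶠ P ≡ true
  allᶠ-true {n = zero}  e = refl
  allᶠ-true {n = suc n} e = cong₂ _∧_ (e zero) (allᶠ-true (e ∘ suc))

  allᶠ-lookup : ∀ {P : Fin n → Bool} → allᶠ P ≡ true → ∀ x → P x ≡ true
  allᶠ-lookup {n = suc n} {P} e x with P zero in P0
  allᶠ-lookup {n = suc n} {P} e zero    | true = P0
  allᶠ-lookup {n = suc n} {P} e (suc x) | true = allᶠ-lookup {P = P ∘ suc} e x

  allᶠ-false : ∀ {P : Fin n → Bool} x → P x ≡ false → allᶠ P ≡ false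
  allᶠ-false {P = P} zero    e = cong (_∧ allᶠ (P ∘ suc)) e
  allᶠ-false {P = P} (suc x) e = trans (cong (P zero ∧_) (allᶠ-false {P = P ∘ suc} x e)) (∧-zeroʳ (P zero))

  anyᶠ-false : ∀ {P : Fin n → Bool} → (∀ x → P x ≡ false) → anyᶠ P ≡ false
  anyᶠ-false {n = zero}  e = refl
  anyᶠ-false {n = suc n} e = cong₂ _∨_ (e zero) (anyᶠ-false (e ∘ suc))

  ∧-interchange : ∀ a b c d → (a ∧ b) ∧ (c ∧ d) ≡ (a ∧ c) ∧ (b ∧ d)
  ∧-interchange false b     c d = refl
  ∧-interchange true  true  c d = refl
  ∧-interchange true  false c d = sym (∧-zeroʳ c)

  allᶠ-∧ : ∀ (P Q : Fin n → Bool) → allᶠ (λ x → P x ∧ Q x) ≡ allᶠ P ∧ allᶠ Q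
  allᶠ-∧ {n = zero}  P Q = refl
  allᶠ-∧ {n = suc n} P Q = trans (cong ((P zero ∧ Q zero) ∧_) (allᶠ-∧ (P ∘ suc) (Q ∘ suc)))
    (∧-interchange (P zero) (Q zero) (allᶠ (P ∘ suc)) (allᶠ (Q ∘ suc)))

  allᶠ-swap : ∀ (P : Fin n → Fin m → Bool) →
              allᶠ (λ x → allᶠ (λ y → P x y)) ≡ allᶠ (λ y → allᶠ (λ x → P x y))
  allᶠ-swap {n = zero} {m} P = sym (allᶠ-true {m} λ _ → refl)
  allᶠ-swap {n = suc n} P = trans (cong (allᶠ (P zero) ∧_) (allᶠ-swap (P ∘ suc)))
    (sym (allᶠ-∧ (P zero) (λ y → allᶠ (λ x → P (suc x) y))))

  -- Merges the conditions of all up arrows below one new cell into a condition on whether the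
  -- column is free.
  allᶠ-⇒ : ∀ (P : Fin n → Bool) b → allᶠ (λ x → P x ⇒ᵇ b) ≡ anyᶠ P ⇒ᵇ b
  allᶠ-⇒ {n = zero}  P b = refl
  allᶠ-⇒ {n = suc n} P b with P zero
  ... | false = allᶠ-⇒ (P ∘ suc) b
  ... | true with b
  ...   | true  = allᶠ-true λ x → ⇒-true (P (suc x))
    where
    ⇒-true : ∀ a → a ⇒ᵇ true ≡ true
    ⇒-true true  = refl
    ⇒-true false = refl
  ...   | false = refl

  -- Bounds the number of free columns by the length, which makes the cutoff in the substitution y +
  -- 1 harmless.
  countᶠ≤n : ∀ (P : Fin n → Bool) → countᶠ P ≤ n
  countᶠ≤n {n = zero}  P = z≤n
  countᶠ≤n {n = suc n} P = ℕₚ.+-mono-≤ (𝟙≤1 (P zero)) (countᶠ≤n (P ∘ suc))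
    where
    𝟙≤1 : ∀ b → 𝟙 b ≤ 1
    𝟙≤1 true  = s≤s z≤n
    𝟙≤1 false = z≤n

  -- Functions rather than vectors, so that the first row and column of an extended filling reduce
  -- by pattern matching. Pointwise equal fillings are then handled by the congruence lemmas below.
  Cells : ℕ → Set
  Cells n = Fin n → Fin n → Label

  cellOK : Shape n → Cells n → Fin n → Fin n → Bool
  cellOK s f p q =
      (not (isBlank (f p q)) ⇒ᵇ isCell s p q)
    ∧ (isLeft (f p q) ⇒ᵇ allᶠ (λ q′ → (toℕ q <ᵇ toℕ q′) ⇒ᵇ isBlank (f p q′)))
    ∧ (isUp (f p q) ⇒ᵇ allᶠ (λ p′ → (toℕ p′ <ᵇ toℕ p) ⇒ᵇ isBlank (f p′ q)))

  valid : Shape n → Cells n → Bool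
  valid s f = allᶠ λ p → allᶠ λ q → cellOK s f p q

  freeRows freeCols : Shape n → Cells n → ℕ
  freeRows s f = countᶠ λ p → isRow s p ∧ not (anyᶠ (λ q → isLeft (f p q)))
  freeCols s f = countᶠ λ q → isCol s q ∧ not (anyᶠ (λ p → isUp (f p q)))

  isAltTableau≡valid : ∀ (s : Shape n) F → isAltTableau s F ≡ valid s (entry F)
  isAltTableau≡valid {n} s F = trans (all-allFin n _) (allᶠ-cong λ p →
    trans (all-allFin n _) (allᶠ-cong λ q →
    cong ((not (isBlank (entry F p q)) ⇒ᵇ isCell s p q) ∧_) (cong₂ _∧_
      (cong (isLeft (entry F p q) ⇒ᵇ_) (all-allFin n _))
      (cong (isUp (entry F p q) ⇒ᵇ_) (all-allFin n _)))))

  numFreeRows≡freeRows : ∀ (s : Shape n) F → numFreeRows s F ≡ freeRows s (entry F)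
  numFreeRows≡freeRows {n} s F = trans (count≡countᶠ {n} _)
    (countᶠ-cong λ p → cong (λ b → isRow s p ∧ not b) (any-allFin n _))

  numFreeCols≡freeCols : ∀ (s : Shape n) F → numFreeCols s F ≡ freeCols s (entry F)
  numFreeCols≡freeCols {n} s F = trans (count≡countᶠ {n} _)
    (countᶠ-cong λ q → cong (λ b → isCol s q ∧ not b) (any-allFin n _))

  module _ (s : Shape n) {f g : Cells n} (f≗g : ∀ p q → f p q ≡ g p q) where

    valid-cong : valid s f ≡ valid s g
    valid-cong = allᶠ-cong λ p → allᶠ-cong λ q →
      cong₂ _∧_ (cong (λ l → not (isBlank l) ⇒ᵇ isCell s p q) (f≗g p q)) (cong₂ _∧_
        (cong₂ (λ l b → isLeft l ⇒ᵇ b) (f≗g p q) (allᶠ-cong λ q′ → cong (λ l → (toℕ q <ᵇ toℕ q′) ⇒ᵇ isBlank l) (f≗g p q′)))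
        (cong₂ (λ l b → isUp l ⇒ᵇ b) (f≗g p q) (allᶠ-cong λ p′ → cong (λ l → (toℕ p′ <ᵇ toℕ p) ⇒ᵇ isBlank l) (f≗g p′ q))))

    freeRows-cong : freeRows s f ≡ freeRows s g
    freeRows-cong = countᶠ-cong λ p → cong (λ b → isRow s p ∧ not b) (anyᶠ-cong λ q → cong isLeft (f≗g p q))

    freeCols-cong : freeCols s f ≡ freeCols s g
    freeCols-cong = countᶠ-cong λ q → cong (λ b → isCol s q ∧ not b) (anyᶠ-cong λ p → cong isUp (f≗g p q))

  -- The new step has index 0. Column 0 stays blank for either kind of step, since a cell (p, q)
  -- needs p < q.
  extend : (Fin n → Label) → Cells n → Cells (suc n)
  extend r g zero    zero    = blank
  extend r g zero    (suc q) = r q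
  extend r g (suc p) zero    = blank
  extend r g (suc p) (suc q) = g p q

  entry-extend : ∀ (r : Vec Label n) (G : Filling n) p q →
                 entry ((blank ∷ r) ∷ V.map (blank ∷_) G) p q ≡ extend (lookup r) (entry G) p q
  entry-extend r G zero    zero    = refl
  entry-extend r G zero    (suc q) = refl
  entry-extend r G (suc p) zero    = cong (λ row → lookup row zero) (lookup-map p (blank ∷_) G)
  entry-extend r G (suc p) (suc q) = cong (λ row → lookup row (suc q)) (lookup-map p (blank ∷_) G)

  -- Up arrows bring no condition of their own: nothing lies above the top row.
  rowOK : (Fin n → Bool) → (Fin n → Label) → Bool
  rowOK c r = allᶠ λ q →
      (not (isBlank (r q)) ⇒ᵇ c q)
    ∧ (isLeft (r q) ⇒ᵇ allᶠ (λ q′ → (toℕ q <ᵇ toℕ q′) ⇒ᵇ isBlank (r q′)))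

  -- A cell of a new topmost row may only be filled above a free column.
  open-column : Bool → Shape n → Cells n → Fin n → Bool
  open-column b s g q = b ∧ isCol s q ∧ not (anyᶠ (λ p → isUp (g p q)))

  -- An old cell gains a single constraint: if it holds an up arrow, the new cell on top of its
  -- column is blank. Collected over a column, these constraints say that the new cell is filled
  -- only above a free column.
  valid-extend : ∀ b (s : Shape n) r g → valid (b ∷ s) (extend r g) ≡ rowOK (open-column b s g) r ∧ valid s g
  valid-extend {n} b s r g = begin
    allᶠ topCell ∧ allᶠ (λ p → allᶠ λ q → cellOK (b ∷ s) (extend r g) (suc p) (suc q))
      ≡⟨ cong (allᶠ topCell ∧_) (allᶠ-cong λ p → allᶠ-cong λ q → split (nb p q) (lf p q) (isUp (g p q)) (isBlank (r q)) (ups p q)) ⟩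
    allᶠ topCell ∧ allᶠ (λ p → allᶠ λ q → cellOK s g p q ∧ (isUp (g p q) ⇒ᵇ isBlank (r q)))
      ≡⟨ cong (allᶠ topCell ∧_) (trans (allᶠ-cong λ p → allᶠ-∧ (cellOK s g p) (λ q → isUp (g p q) ⇒ᵇ isBlank (r q))) (allᶠ-∧ {n} _ _)) ⟩
    allᶠ topCell ∧ (valid s g ∧ allᶠ (λ p → allᶠ λ q → isUp (g p q) ⇒ᵇ isBlank (r q)))
      ≡⟨ cong (λ t → allᶠ topCell ∧ (valid s g ∧ t))
           (trans (allᶠ-swap λ p q → isUp (g p q) ⇒ᵇ isBlank (r q)) (allᶠ-cong λ q → allᶠ-⇒ (λ p → isUp (g p q)) (isBlank (r q)))) ⟩
    allᶠ topCell ∧ (valid s g ∧ allᶠ noUpBelow)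
      ≡⟨ rotate (allᶠ topCell) (valid s g) (allᶠ noUpBelow) ⟩
    (allᶠ topCell ∧ allᶠ noUpBelow) ∧ valid s g
      -- No row index is below 0, so the up-arrow condition of a top cell has reduced to
      -- implications with premise `false`.
      ≡⟨ cong (_∧ valid s g) (trans (sym (allᶠ-∧ topCell noUpBelow)) (allᶠ-cong λ q →
           top (r q) b (isCol s q) (later q) (allᶠ {n} (λ p → false ⇒ᵇ isBlank (g p q))) (allᶠ-true {n} λ _ → refl) (anyᶠ λ p → isUp (g p q)))) ⟩
    rowOK (open-column b s g) r ∧ valid s g ∎
    where
    open ≡-Reasoning
    later : Fin n → Bool
    later q = allᶠ λ q′ → (toℕ q <ᵇ toℕ q′) ⇒ᵇ isBlank (r q′)
    topCell noUpBelow : Fin n → Bool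
    topCell q = cellOK (b ∷ s) (extend r g) zero (suc q)
    noUpBelow q = anyᶠ (λ p → isUp (g p q)) ⇒ᵇ isBlank (r q)
    nb lf ups : Fin n → Fin n → Bool
    nb p q = not (isBlank (g p q)) ⇒ᵇ isCell s p q
    lf p q = isLeft (g p q) ⇒ᵇ allᶠ (λ q′ → (toℕ q <ᵇ toℕ q′) ⇒ᵇ isBlank (g p q′))
    ups p q = allᶠ λ p′ → (toℕ p′ <ᵇ toℕ p) ⇒ᵇ isBlank (g p′ q)
    split : ∀ a b u x y → a ∧ b ∧ (u ⇒ᵇ (x ∧ y)) ≡ (a ∧ b ∧ (u ⇒ᵇ y)) ∧ (u ⇒ᵇ x)
    split false b     u     x     y = refl
    split true  false u     x     y = refl
    split true  true  false x     y = refl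
    split true  true  true  true  y = sym (∧-identityʳ y)
    split true  true  true  false y = sym (∧-zeroʳ y)
    rotate : ∀ a b c → a ∧ (b ∧ c) ≡ (a ∧ c) ∧ b
    rotate false b     c = refl
    rotate true  true  c = sym (∧-identityʳ c)
    rotate true  false c = sym (∧-zeroʳ c)
    top : ∀ l b col x y → y ≡ true → ∀ u →
          ((not (isBlank l) ⇒ᵇ (b ∧ col ∧ true)) ∧ (isLeft l ⇒ᵇ x) ∧ (isUp l ⇒ᵇ y)) ∧ (u ⇒ᵇ isBlank l) ≡
          (not (isBlank l) ⇒ᵇ (b ∧ col ∧ not u)) ∧ (isLeft l ⇒ᵇ x)
    top blank b     col   x     y y≡ true  = refl
    top blank b     col   x     y y≡ false = refl
    top left  false col   x     y y≡ u     = refl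
    top left  true  false x     y y≡ u     = refl
    top left  true  true  x     y y≡ true  = ∧-zeroʳ (x ∧ true)
    top left  true  true  true  y y≡ false = refl
    top left  true  true  false y y≡ false = refl
    top up    false col   x     y y≡ u     = refl
    top up    true  false x     y y≡ u     = refl
    top up    true  true  x     y y≡ true  = ∧-zeroʳ y
    top up    true  true  x     y y≡ false = trans (∧-identityʳ y) y≡

  labels : List Label
  labels = blank ∷ left ∷ up ∷ []

  isBlank⇒blank : ∀ l → isBlank l ≡ true → l ≡ blank
  isBlank⇒blank blank e = refl

  module _ {r r′ : Fin n → Label} (r≗r′ : ∀ q → r q ≡ r′ q) (c : Fin n → Bool) where

    rowOK-cong : rowOK c r ≡ rowOK c r′
    rowOK-cong = allᶠ-cong λ q → cong₂ _∧_
      (cong (λ l → not (isBlank l) ⇒ᵇ c q) (r≗r′ q))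
      (cong₂ (λ l b → isLeft l ⇒ᵇ b) (r≗r′ q) (allᶠ-cong λ q′ → cong (λ l → (toℕ q <ᵇ toℕ q′) ⇒ᵇ isBlank l) (r≗r′ q′)))

  anyLeft : (Fin n → Label) → Bool
  anyLeft r = anyᶠ (λ q → isLeft (r q))

  allBlank : (Fin n → Label) → Bool
  allBlank r = allᶠ (λ q → isBlank (r q))

  stillFree : (Fin n → Bool) → (Fin n → Label) → ℕ
  stillFree c r = countᶠ (λ q → c q ∧ not (isUp (r q)))

  module _ (c : Fin n → Bool) (r : Fin n → Label) (r-blank : allBlank r ≡ true) where

    private
      r≗blank : ∀ q → r q ≡ blank
      r≗blank q = isBlank⇒blank (r q) (allᶠ-lookup r-blank q)

    allBlank⇒rowOK : rowOK c r ≡ true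
    allBlank⇒rowOK = trans (rowOK-cong r≗blank c) (allᶠ-true {n} λ _ → refl)

    allBlank⇒stillFree : stillFree c r ≡ countᶠ c
    allBlank⇒stillFree = countᶠ-cong λ q → trans (cong (λ l → c q ∧ not (isUp l)) (r≗blank q)) (∧-identityʳ (c q))

  ∑-labels : ∀ n (f : Vec Label (suc n) → ℕ) →
             ∑ (allVecs labels (suc n)) f ≡
             ∑ (allVecs labels n) (f ∘ (blank ∷_)) ℕ.+
               (∑ (allVecs labels n) (f ∘ (left ∷_)) ℕ.+ ∑ (allVecs labels n) (f ∘ (up ∷_)))
  ∑-labels n f = trans (∑-allVecs labels n f)
    (cong (λ t → ∑ (allVecs labels n) (f ∘ (blank ∷_)) ℕ.+ (∑ (allVecs labels n) (f ∘ (left ∷_)) ℕ.+ t))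
          (ℕₚ.+-identityʳ _))

  -- The indicator leaves exactly one row in the sum.
  ∑-allBlank : ∀ n (f : Vec Label n → ℕ) K → (∀ r → allBlank (lookup r) ≡ true → f r ≡ K) →
               ∑ (allVecs labels n) (λ r → 𝟙 (allBlank (lookup r)) ℕ.* f r) ≡ K
  ∑-allBlank zero    f K e = trans (ℕₚ.+-identityʳ _) (trans (ℕₚ.*-identityˡ _) (e [] refl))
  ∑-allBlank (suc n) f K e = begin
    ∑ (allVecs labels (suc n)) (λ r → 𝟙 (allBlank (lookup r)) ℕ.* f r)
      ≡⟨ ∑-labels n (λ r → 𝟙 (allBlank (lookup r)) ℕ.* f r) ⟩
    ∑ (allVecs labels n) (λ r → 𝟙 (allBlank (lookup r)) ℕ.* f (blank ∷ r)) ℕ.+ _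
      ≡⟨ cong₂ ℕ._+_ (∑-allBlank n (f ∘ (blank ∷_)) K (λ r → e (blank ∷ r)))
           (cong₂ ℕ._+_ (∑-0 (allVecs labels n) λ _ → refl) (∑-0 (allVecs labels n) λ _ → refl)) ⟩
    K ℕ.+ 0
      ≡⟨ ℕₚ.+-identityʳ K ⟩
    K ∎
    where open ≡-Reasoning

  -- For w = (y ^_), these are (1 + y)^J and y ((1 + y)^J - y^J): the new top row has J open cells and
  -- contains no left arrow, respectively one.
  noLeftSum oneLeftSum : (ℕ → ℕ) → ℕ → ℕ
  noLeftSum w zero    = w 0
  noLeftSum w (suc J) = noLeftSum (w ∘ suc) J ℕ.+ noLeftSum w J
  oneLeftSum w zero    = 0
  oneLeftSum w (suc J) = oneLeftSum (w ∘ suc) J ℕ.+ oneLeftSum w J ℕ.+ w (suc J)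

  -- For `w = (y ^_)`: y ((1 + y)^J - y^J) + y^(J + 1) = y (1 + y)^J. The added power is the origin
  -- of the term - u y P (n).
  oneLeftSum-noLeftSum : ∀ w J → oneLeftSum w J ℕ.+ w (suc J) ≡ noLeftSum (w ∘ suc) J
  oneLeftSum-noLeftSum w zero    = refl
  oneLeftSum-noLeftSum w (suc J) = begin
    oneLeftSum (w ∘ suc) J ℕ.+ oneLeftSum w J ℕ.+ w (suc J) ℕ.+ w (suc (suc J))
      ≡⟨ solve 4 (λ a b c d → a :+ b :+ c :+ d := (a :+ d) :+ (b :+ c)) refl
           (oneLeftSum (w ∘ suc) J) (oneLeftSum w J) (w (suc J)) (w (suc (suc J))) ⟩
    (oneLeftSum (w ∘ suc) J ℕ.+ w (suc (suc J))) ℕ.+ (oneLeftSum w J ℕ.+ w (suc J))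
      ≡⟨ cong₂ ℕ._+_ (oneLeftSum-noLeftSum (w ∘ suc) J) (oneLeftSum-noLeftSum w J) ⟩
    noLeftSum (w ∘ suc) (suc J) ∎
    where open ≡-Reasoning
          open +-*-Solver

  rowTerm : (Fin n → Bool) → (Bool → ℕ → ℕ) → Vec Label n → ℕ
  rowTerm c w r = 𝟙 (rowOK c (lookup r)) ℕ.* w (anyLeft (lookup r)) (stillFree c (lookup r))

  -- Split on the rightmost cell. If it is open, a blank keeps its column free, an up arrow takes it
  -- away, and both leave the same problem to the left; a left arrow forces blanks, so every open
  -- column stays free. A closed cell is blank.
  rowSum : ∀ n (c : Fin n → Bool) (w : Bool → ℕ → ℕ) →
           ∑ (allVecs labels n) (rowTerm c w) ≡
           noLeftSum (w false) (countᶠ c) ℕ.+ oneLeftSum (w true) (countᶠ c)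
  rowSum zero    c w = trans (ℕₚ.+-identityʳ _) (trans (ℕₚ.*-identityˡ _) (sym (ℕₚ.+-identityʳ _)))
  rowSum (suc n) c w = trans (∑-labels n (rowTerm c w)) (byFirst (c zero) refl)
    where
    open ≡-Reasoning
    open +-*-Solver
    rows = allVecs labels n
    c′ = c ∘ suc
    byFirst : ∀ c₀ → c zero ≡ c₀ →
      ∑ rows (rowTerm c w ∘ (blank ∷_)) ℕ.+ (∑ rows (rowTerm c w ∘ (left ∷_)) ℕ.+ ∑ rows (rowTerm c w ∘ (up ∷_))) ≡
      noLeftSum (w false) (𝟙 (c zero) ℕ.+ countᶠ c′) ℕ.+ oneLeftSum (w true) (𝟙 (c zero) ℕ.+ countᶠ c′)
    byFirst true c₀ rewrite c₀ = begin
      ∑ rows (rowTerm c′ (λ a → w a ∘ suc)) ℕ.+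
        (∑ rows (λ r → 𝟙 ((allBlank (lookup r)) ∧ rowOK c′ (lookup r)) ℕ.* w true (suc (stillFree c′ (lookup r))))
         ℕ.+ ∑ rows (rowTerm c′ w))
        ≡⟨ cong₂ ℕ._+_ (rowSum n c′ (λ a → w a ∘ suc)) (cong₂ ℕ._+_ leftCase (rowSum n c′ w)) ⟩
      noLeftSum (w false ∘ suc) cols ℕ.+ oneLeftSum (w true ∘ suc) cols ℕ.+
        (w true (suc cols) ℕ.+ (noLeftSum (w false) cols ℕ.+ oneLeftSum (w true) cols))
        ≡⟨ solve 5 (λ a b c d e → (a :+ b) :+ (c :+ (d :+ e)) := (a :+ d) :+ ((b :+ e) :+ c)) refl
             (noLeftSum (w false ∘ suc) cols) (oneLeftSum (w true ∘ suc) cols) (w true (suc cols))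
             (noLeftSum (w false) cols) (oneLeftSum (w true) cols) ⟩
      noLeftSum (w false) (suc cols) ℕ.+ oneLeftSum (w true) (suc cols) ∎
      where
      cols = countᶠ c′
      leftCase : ∑ rows (λ r → 𝟙 (allBlank (lookup r) ∧ rowOK c′ (lookup r)) ℕ.* w true (suc (stillFree c′ (lookup r)))) ≡ w true (suc cols)
      leftCase = trans
        (∑-cong rows λ r → trans (cong (ℕ._* w true (suc (stillFree c′ (lookup r)))) (𝟙-∧ (allBlank (lookup r)) (rowOK c′ (lookup r))))
                                 (ℕₚ.*-assoc (𝟙 (allBlank (lookup r))) (𝟙 (rowOK c′ (lookup r))) _))
        (∑-allBlank n (λ r → 𝟙 (rowOK c′ (lookup r)) ℕ.* w true (suc (stillFree c′ (lookup r)))) (w true (suc cols)) λ r b →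
          trans (cong₂ (λ ok t → 𝟙 ok ℕ.* w true (suc t)) (allBlank⇒rowOK c′ (lookup r) b) (allBlank⇒stillFree c′ (lookup r) b))
                (ℕₚ.*-identityˡ _))
    byFirst false c₀ rewrite c₀ = begin
      ∑ rows (rowTerm c′ w) ℕ.+ _
        ≡⟨ cong₂ ℕ._+_ (rowSum n c′ w) (cong₂ ℕ._+_ (∑-0 rows λ _ → refl) (∑-0 rows λ _ → refl)) ⟩
      noLeftSum (w false) (countᶠ c′) ℕ.+ oneLeftSum (w true) (countᶠ c′) ℕ.+ 0
        ≡⟨ ℕₚ.+-identityʳ _ ⟩
      noLeftSum (w false) (countᶠ c′) ℕ.+ oneLeftSum (w true) (countᶠ c′) ∎

  -- Induction on the number of rows, which is why `m` is separate from `n`: in each row the choices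
  -- `left` and `up` at column 0 give zero summands.
  ∑-blankColumn : ∀ n m (f : Vec (Vec Label (suc n)) m → ℕ) →
                  (∀ V p → isBlank (lookup (lookup V p) zero) ≡ false → f V ≡ 0) →
                  ∑ (allVecs (allVecs labels (suc n)) m) f ≡
                  ∑ (allVecs (allVecs labels n) m) (λ V → f (V.map (blank ∷_) V))
  ∑-blankColumn n zero    f f-zero = refl
  ∑-blankColumn n (suc m) f f-zero = begin
    ∑ (allVecs (allVecs labels (suc n)) (suc m)) f
      ≡⟨ ∑-allVecs (allVecs labels (suc n)) m f ⟩
    ∑ (allVecs labels (suc n)) (λ r → ∑ (allVecs (allVecs labels (suc n)) m) (λ V → f (r ∷ V)))
      ≡⟨ ∑-cong (allVecs labels (suc n)) (λ r → ∑-blankColumn n m (λ V → f (r ∷ V)) λ V p → f-zero (r ∷ V) (suc p)) ⟩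
    ∑ (allVecs labels (suc n)) inner
      ≡⟨ ∑-labels n inner ⟩
    ∑ (allVecs labels n) (inner ∘ (blank ∷_)) ℕ.+
      (∑ (allVecs labels n) (inner ∘ (left ∷_)) ℕ.+ ∑ (allVecs labels n) (inner ∘ (up ∷_)))
      ≡⟨ cong (∑ (allVecs labels n) (inner ∘ (blank ∷_)) ℕ.+_) (cong₂ ℕ._+_
           (∑-0 (allVecs labels n) λ r → ∑-0 (allVecs (allVecs labels n) m) λ V → f-zero ((left ∷ r) ∷ V.map (blank ∷_) V) zero refl)
           (∑-0 (allVecs labels n) λ r → ∑-0 (allVecs (allVecs labels n) m) λ V → f-zero ((up ∷ r) ∷ V.map (blank ∷_) V) zero refl)) ⟩
    ∑ (allVecs labels n) (inner ∘ (blank ∷_)) ℕ.+ 0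
      ≡⟨ ℕₚ.+-identityʳ _ ⟩
    ∑ (allVecs labels n) (inner ∘ (blank ∷_))
      ≡⟨ ∑-allVecs (allVecs labels n) m (λ V → f (V.map (blank ∷_) V)) ⟨
    ∑ (allVecs (allVecs labels n) (suc m)) (λ V → f (V.map (blank ∷_) V)) ∎
    where
    open ≡-Reasoning
    inner : Vec Label (suc n) → ℕ
    inner r = ∑ (allVecs (allVecs labels n) m) (λ V → f (r ∷ V.map (blank ∷_) V))

  -- An arbitrary function of the numbers of rows, free rows and free columns. Its values absorb the
  -- change of statistics when a step is prepended, and an indicator extracts a single count.
  StatWeight : Set
  StatWeight = ℕ → ℕ → ℕ → ℕ

  weightedTerm : StatWeight → Shape n → Cells n → ℕ
  weightedTerm w s f = 𝟙 (valid s f) ℕ.* w (countᶠ (isRow s)) (freeRows s f) (freeCols s f)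

  weightedTerm-cong : ∀ w (s : Shape n) {f g : Cells n} → (∀ p q → f p q ≡ g p q) → weightedTerm w s f ≡ weightedTerm w s g
  weightedTerm-cong w s e = cong₂ ℕ._*_ (cong 𝟙 (valid-cong s e)) (cong₂ (w _) (freeRows-cong s e) (freeCols-cong s e))

  tableauSum : ℕ → StatWeight → ℕ
  tableauSum n w = ∑ (allShapes n) λ s → ∑ (allFillings n) λ F → weightedTerm w s (entry F)

  invalid-column0 : ∀ (s : Shape (suc n)) F p → isBlank (lookup (lookup F p) zero) ≡ false → valid s (entry F) ≡ false
  invalid-column0 s F p e = allᶠ-false {P = λ p → allᶠ (cellOK s (entry F) p)} p
    (allᶠ-false {P = cellOK s (entry F) p} zero
      (∧-falseˡ (trans (cong (λ b → not b ⇒ᵇ isCell s p zero) e)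
        (trans (cong (isRow s p ∧_) (∧-zeroʳ (isCol s zero))) (∧-zeroʳ (isRow s p))))))
    where
    ∧-falseˡ : ∀ {a b} → a ≡ false → a ∧ b ≡ false
    ∧-falseˡ refl = refl

  fillingSum-extend : ∀ w b (s : Shape n) →
    ∑ (allFillings (suc n)) (λ F → weightedTerm w (b ∷ s) (entry F)) ≡
    ∑ (allFillings n) (λ G → ∑ (allVecs labels n) (λ r → weightedTerm w (b ∷ s) (extend (lookup r) (entry G))))
  fillingSum-extend {n} w b s = begin
    ∑ (allFillings (suc n)) (λ F → weightedTerm w (b ∷ s) (entry F))
      ≡⟨ ∑-blankColumn n (suc n) _ (λ F p e →
           cong (ℕ._* w (countᶠ (isRow (b ∷ s))) (freeRows (b ∷ s) (entry F)) (freeCols (b ∷ s) (entry F)))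
                (cong 𝟙 (invalid-column0 (b ∷ s) F p e))) ⟩
    ∑ (allVecs (allVecs labels n) (suc n)) (λ V → weightedTerm w (b ∷ s) (entry (V.map (blank ∷_) V)))
      ≡⟨ ∑-allVecs (allVecs labels n) n _ ⟩
    ∑ (allVecs labels n) (λ r → ∑ (allFillings n) (λ G → weightedTerm w (b ∷ s) (entry ((blank ∷ r) ∷ V.map (blank ∷_) G))))
      ≡⟨ ∑-swap (allVecs labels n) (allFillings n) _ ⟩
    ∑ (allFillings n) (λ G → ∑ (allVecs labels n) (λ r → weightedTerm w (b ∷ s) (entry ((blank ∷ r) ∷ V.map (blank ∷_) G))))
      ≡⟨ ∑-cong (allFillings n) (λ G → ∑-cong (allVecs labels n) λ r → weightedTerm-cong w (b ∷ s) (entry-extend r G)) ⟩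
    ∑ (allFillings n) (λ G → ∑ (allVecs labels n) (λ r → weightedTerm w (b ∷ s) (extend (lookup r) (entry G)))) ∎
    where open ≡-Reasoning

  -- Prepending a west step: the new column has no cells.
  rowSum-west : ∀ w (s : Shape n) g →
    ∑ (allVecs labels n) (λ r → weightedTerm w (false ∷ s) (extend (lookup r) g)) ≡ weightedTerm (λ k i j → w k i (suc j)) s g
  rowSum-west {n} w s g = begin
    ∑ rows (λ r → weightedTerm w (false ∷ s) (extend (lookup r) g))
      ≡⟨ ∑-cong rows (λ r → trans (cong (ℕ._* stat r) (trans (cong 𝟙 (trans (valid-extend false s (lookup r) g)
             (cong (_∧ valid s g) (allᶠ-cong λ q → closed (lookup r q) _))))
             (𝟙-∧ (allBlank (lookup r)) (valid s g))))
           (ℕₚ.*-assoc (𝟙 (allBlank (lookup r))) (𝟙 (valid s g)) (stat r))) ⟩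
    ∑ rows (λ r → 𝟙 (allBlank (lookup r)) ℕ.* (𝟙 (valid s g) ℕ.* stat r))
      ≡⟨ ∑-allBlank n _ _ (λ r e → cong (λ t → 𝟙 (valid s g) ℕ.* w (countᶠ (isRow s)) (freeRows s g) t) (cong₂ ℕ._+_
           (cong (λ b → 𝟙 (not b)) (anyᶠ-false {n} λ _ → refl))
           (countᶠ-cong λ q → cong (λ l → isCol s q ∧ not (isUp l ∨ anyᶠ (λ p → isUp (g p q)))) (isBlank⇒blank _ (allᶠ-lookup e q))))) ⟩
    weightedTerm (λ k i j → w k i (suc j)) s g ∎
    where
    open ≡-Reasoning
    rows = allVecs labels n
    stat : Vec Label n → ℕ
    stat r = w (countᶠ (isRow s)) (freeRows s g) (freeCols (false ∷ s) (extend (lookup r) g))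
    closed : ∀ l b → (not (isBlank l) ⇒ᵇ false) ∧ (isLeft l ⇒ᵇ b) ≡ isBlank l
    closed blank b = refl
    closed left  b = refl
    closed up    b = refl

  -- The new row is free exactly when it has no left arrow, hence `suc i` in the first term and `i`
  -- in the second.
  rowSum-south : ∀ w (s : Shape n) g →
    ∑ (allVecs labels n) (λ r → weightedTerm w (true ∷ s) (extend (lookup r) g)) ≡
    weightedTerm (λ k i j → noLeftSum (w (suc k) (suc i)) j ℕ.+ oneLeftSum (w (suc k) i) j) s g
  rowSum-south {n} w s g = begin
    ∑ rows (λ r → weightedTerm w (true ∷ s) (extend (lookup r) g))
      ≡⟨ ∑-cong rows perRow ⟩
    ∑ rows (λ r → 𝟙 (valid s g) ℕ.* rowTerm c w′ r)
      ≡⟨ ∑-*ˡ rows (𝟙 (valid s g)) (rowTerm c w′) ⟩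
    𝟙 (valid s g) ℕ.* ∑ rows (rowTerm c w′)
      ≡⟨ cong (𝟙 (valid s g) ℕ.*_) (rowSum n c w′) ⟩
    weightedTerm (λ k i j → noLeftSum (w (suc k) (suc i)) j ℕ.+ oneLeftSum (w (suc k) i) j) s g ∎
    where
    open ≡-Reasoning
    rows = allVecs labels n
    c = open-column true s g
    w′ : Bool → ℕ → ℕ
    w′ l = w (suc (countᶠ (isRow s))) (𝟙 (not l) ℕ.+ freeRows s g)
    reassoc : ∀ a u x → a ∧ not (u ∨ x) ≡ (a ∧ not x) ∧ not u
    reassoc false u     x = refl
    reassoc true  true  x = sym (∧-zeroʳ (not x))
    reassoc true  false x = sym (∧-identityʳ (not x))
    free : ∀ r → freeCols (true ∷ s) (extend r g) ≡ stillFree c r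
    free r = countᶠ-cong λ q → reassoc (isCol s q) (isUp (r q)) (anyᶠ (λ p → isUp (g p q)))
    perRow : ∀ r → weightedTerm w (true ∷ s) (extend (lookup r) g) ≡ 𝟙 (valid s g) ℕ.* rowTerm c w′ r
    perRow r = trans
      (cong₂ ℕ._*_ (trans (cong 𝟙 (valid-extend true s (lookup r) g)) (trans (𝟙-∧ (rowOK c (lookup r)) (valid s g)) (ℕₚ.*-comm (𝟙 (rowOK c (lookup r))) _)))
        (cong (w′ (anyLeft (lookup r))) (free (lookup r))))
      (ℕₚ.*-assoc (𝟙 (valid s g)) (𝟙 (rowOK c (lookup r))) _)

  -- The restriction to `j ≤ n` admits weights that agree only up to a finite cutoff.
  tableauSum-cong : ∀ n {w w′ : StatWeight} → (∀ k i j → j ≤ n → w k i j ≡ w′ k i j) → tableauSum n w ≡ tableauSum n w′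
  tableauSum-cong n e = ∑-cong (allShapes n) λ s → ∑-cong (allFillings n) λ F →
    cong (𝟙 (valid s (entry F)) ℕ.*_) (e _ _ _ (countᶠ≤n _))

  tableauSum-+ : ∀ n (w w′ : StatWeight) →
                 tableauSum n (λ k i j → w k i j ℕ.+ w′ k i j) ≡ tableauSum n w ℕ.+ tableauSum n w′
  tableauSum-+ n w w′ = trans
    (∑-cong (allShapes n) λ s → trans (∑-cong (allFillings n) λ F → ℕₚ.*-distribˡ-+ (𝟙 (valid s (entry F))) _ _)
                                      (∑-+ (allFillings n) _ _))
    (∑-+ (allShapes n) _ _)

  tableauSum-*ˡ : ∀ n x (w : StatWeight) → tableauSum n (λ k i j → x ℕ.* w k i j) ≡ x ℕ.* tableauSum n w
  tableauSum-*ˡ n x w = trans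
    (∑-cong (allShapes n) λ s → trans (∑-cong (allFillings n) λ F → swap (𝟙 (valid s (entry F))) x _)
                                      (∑-*ˡ (allFillings n) x _))
    (∑-*ˡ (allShapes n) x _)
    where
    open +-*-Solver
    swap : ∀ a b c → a ℕ.* (b ℕ.* c) ≡ b ℕ.* (a ℕ.* c)
    swap = solve 3 (λ a b c → a :* (b :* c) := b :* (a :* c)) refl

  tableauSum-suc : ∀ n w → tableauSum (suc n) w ≡
    tableauSum n (λ k i j → noLeftSum (w (suc k) (suc i)) j ℕ.+ oneLeftSum (w (suc k) i) j) ℕ.+
    tableauSum n (λ k i j → w k i (suc j))
  tableauSum-suc n w = begin
    tableauSum (suc n) w
      ≡⟨ ∑-allVecs (true ∷ false ∷ []) n _ ⟩
    ∑ (allShapes n) (λ s → ∑ (allFillings (suc n)) λ F → weightedTerm w (true ∷ s) (entry F)) ℕ.+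
      (∑ (allShapes n) (λ s → ∑ (allFillings (suc n)) λ F → weightedTerm w (false ∷ s) (entry F)) ℕ.+ 0)
      ≡⟨ cong₂ ℕ._+_
           (∑-cong (allShapes n) λ s → trans (fillingSum-extend w true s) (∑-cong (allFillings n) λ G → rowSum-south w s (entry G)))
           (trans (ℕₚ.+-identityʳ _)
             (∑-cong (allShapes n) λ s → trans (fillingSum-extend w false s) (∑-cong (allFillings n) λ G → rowSum-west w s (entry G)))) ⟩
    _ ∎
    where open ≡-Reasoning

  -- In generating functions: P(n+1; y) + u y P(n; y) = y P(n; y) + u (x + y) P(n; y + 1).
  tableauSum-step : ∀ n w →
    tableauSum (suc n) w ℕ.+ tableauSum n (λ k i j → w (suc k) i (suc j)) ≡
    tableauSum n (λ k i j → w k i (suc j)) ℕ.+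
      (tableauSum n (λ k i → noLeftSum (w (suc k) (suc i))) ℕ.+ tableauSum n (λ k i → noLeftSum (w (suc k) i ∘ suc)))
  tableauSum-step n w = begin
    tableauSum (suc n) w ℕ.+ d
      ≡⟨ cong (ℕ._+ d) (trans (tableauSum-suc n w) (cong (ℕ._+ a) (tableauSum-+ n w₁ w₂))) ⟩
    b ℕ.+ c ℕ.+ a ℕ.+ d
      ≡⟨ solve 4 (λ a b c d → b :+ c :+ a :+ d := a :+ (b :+ (c :+ d))) refl a b c d ⟩
    a ℕ.+ (b ℕ.+ (c ℕ.+ d))
      ≡⟨ cong (λ t → a ℕ.+ (b ℕ.+ t)) (trans (sym (tableauSum-+ n w₂ w₃))
           (tableauSum-cong n λ k i j _ → oneLeftSum-noLeftSum (w (suc k) i) j)) ⟩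
    a ℕ.+ (b ℕ.+ tableauSum n (λ k i → noLeftSum (w (suc k) i ∘ suc))) ∎
    where
    open ≡-Reasoning
    open +-*-Solver
    w₁ w₂ w₃ : StatWeight
    w₁ k i = noLeftSum (w (suc k) (suc i))
    w₂ k i = oneLeftSum (w (suc k) i)
    w₃ k i j = w (suc k) i (suc j)
    a = tableauSum n (λ k i j → w k i (suc j))
    b = tableauSum n w₁
    c = tableauSum n w₂
    d = tableauSum n w₃

open Tableaux

-- Rational coefficients of exp and ln.

module ℚS = NatSolver (CommutativeRing.commutativeSemiring Qₚ.+-*-commutativeRing)

-- Recursive, so that `ι (suc n)` unfolds to `1ℚ + ι n`, the form in which Leibniz-rule inductions
-- produce it.
ι : ℕ → ℚ
ι zero    = 0ℚ
ι (suc n) = 1ℚ + ι n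

ι-+ : ∀ m n → ι (m ℕ.+ n) ≡ ι m + ι n
ι-+ zero    n = sym (Qₚ.+-identityˡ (ι n))
ι-+ (suc m) n = trans (cong (1ℚ +_) (ι-+ m n)) (sym (Qₚ.+-assoc 1ℚ (ι m) (ι n)))

ι-* : ∀ m n → ι (m ℕ.* n) ≡ ι m * ι n
ι-* zero    n = sym (Qₚ.*-zeroˡ (ι n))
ι-* (suc m) n = begin
  ι (n ℕ.+ m ℕ.* n)     ≡⟨ ι-+ n (m ℕ.* n) ⟩
  ι n + ι (m ℕ.* n)     ≡⟨ cong (_+_ (ι n)) (ι-* m n) ⟩
  ι n + ι m * ι n       ≡⟨ cong (_+ ι m * ι n) (sym (Qₚ.*-identityˡ (ι n))) ⟩
  1ℚ * ι n + ι m * ι n  ≡⟨ sym (Qₚ.*-distribʳ-+ (ι n) 1ℚ (ι m)) ⟩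
  (1ℚ + ι m) * ι n      ∎
  where open ≡-Reasoning

toℚᵘ-/ : ∀ p d → toℚᵘ (p / suc d) U.≃ U.mkℚᵘ p d
toℚᵘ-/ p d = Qₚ.toℚᵘ-fromℚᵘ (U.mkℚᵘ p d)

n/1≡ι : ∀ n → ℤ.+ n / 1 ≡ ι n
n/1≡ι zero    = refl
n/1≡ι (suc n) = trans (Qₚ.toℚᵘ-injective eq) (cong (1ℚ +_) (n/1≡ι n))
  where
  eq : toℚᵘ (ℤ.+ suc n / 1) U.≃ toℚᵘ (1ℚ + ℤ.+ n / 1)
  eq = Uₚ.≃-trans (toℚᵘ-/ (ℤ.+ suc n) 0)
      (Uₚ.≃-trans (U.*≡* (cong (λ t → (ℤ.+ 1 ℤ.+ t) ℤ.* ℤ.+ 1) (sym (ℤₚ.*-identityʳ (ℤ.+ n)))))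
      (Uₚ.≃-sym (Uₚ.≃-trans (Qₚ.toℚᵘ-homo-+ 1ℚ (ℤ.+ n / 1)) (Uₚ.+-congʳ U.1ℚᵘ (toℚᵘ-/ (ℤ.+ n) 0)))))

ι*/ : ∀ d p → ι (suc d) * (p / suc d) ≡ p / 1
ι*/ d p = trans (cong (_* (p / suc d)) (sym (n/1≡ι (suc d)))) (Qₚ.toℚᵘ-injective eq)
  where
  eq : toℚᵘ ((ℤ.+ suc d / 1) * (p / suc d)) U.≃ toℚᵘ (p / 1)
  eq = Uₚ.≃-trans (Qₚ.toℚᵘ-homo-* (ℤ.+ suc d / 1) (p / suc d))
      (Uₚ.≃-trans (Uₚ.*-cong (toℚᵘ-/ (ℤ.+ suc d) 0) (toℚᵘ-/ p d))
      (Uₚ.≃-trans (U.*≡* lem) (Uₚ.≃-sym (toℚᵘ-/ p 0))))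
    where
    lem : (ℤ.+ suc d ℤ.* p) ℤ.* ℤ.+ 1 ≡ p ℤ.* ℤ.+ suc (d ℕ.+ 0)
    lem rewrite ℕₚ.+-identityʳ d = trans (ℤₚ.*-identityʳ (ℤ.+ suc d ℤ.* p)) (ℤₚ.*-comm (ℤ.+ suc d) p)

ι-cancel : ∀ n {p q} → ι (suc n) * p ≡ ι (suc n) * q → p ≡ q
ι-cancel n {p} {q} eq = trans (sym (unit p)) (trans (cong (r *_) eq) (unit q))
  where
  r = ℤ.+ 1 / suc n
  unit : ∀ t → r * (ι (suc n) * t) ≡ t
  unit t = begin
    r * (ι (suc n) * t) ≡⟨ Qₚ.*-assoc r (ι (suc n)) t ⟨
    r * ι (suc n) * t   ≡⟨ cong (_* t) (trans (Qₚ.*-comm r (ι (suc n))) (ι*/ n (ℤ.+ 1))) ⟩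
    1ℚ * t              ≡⟨ Qₚ.*-identityˡ t ⟩
    t                   ∎
    where open ≡-Reasoning

ι*1/ : ∀ m .{{_ : ℕ.NonZero m}} a → ι m * ((ℤ.+ a) / m) ≡ ι a
ι*1/ (suc m) a = trans (ι*/ m (ℤ.+ a)) (n/1≡ι a)

!*invFact : ∀ m → ι (m !) * invFact m ≡ 1ℚ
!*invFact m = ι*1/ (m !) {{m ℕₚ.!≢0}} 1

ι-cancel! : ∀ m {p q} → ι (m !) * p ≡ ι (m !) * q → p ≡ q
ι-cancel! m eq with m ! | m ℕₚ.!≢0
... | suc d | _ = ι-cancel d eq

-- The coefficient form of exp′ = exp.
invFact-suc : ∀ m → ι (suc m) * invFact (suc m) ≡ invFact m
invFact-suc m = ι-cancel! m (begin
  ι (m !) * (ι (suc m) * invFact (suc m)) ≡⟨ Qₚ.*-assoc (ι (m !)) (ι (suc m)) _ ⟨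
  ι (m !) * ι (suc m) * invFact (suc m)   ≡⟨ cong (_* invFact (suc m)) (trans (Qₚ.*-comm (ι (m !)) (ι (suc m))) (sym (ι-* (suc m) (m !)))) ⟩
  ι (suc m !) * invFact (suc m)           ≡⟨ !*invFact (suc m) ⟩
  1ℚ                                      ≡⟨ !*invFact m ⟨
  ι (m !) * invFact m                     ∎)
  where open ≡-Reasoning

/!≡ι*invFact : ∀ m a → _/_ (ℤ.+ a) (m !) {{m ℕₚ.!≢0}} ≡ ι a * invFact m
/!≡ι*invFact m a = ι-cancel! m (begin
  ι (m !) * _/_ (ℤ.+ a) (m !) {{m ℕₚ.!≢0}} ≡⟨ ι*1/ (m !) {{m ℕₚ.!≢0}} a ⟩
  ι a                                    ≡⟨ Qₚ.*-identityʳ (ι a) ⟨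
  ι a * 1ℚ                               ≡⟨ cong (ι a *_) (!*invFact m) ⟨
  ι a * (ι (m !) * invFact m)            ≡⟨ solve 3 (λ x y z → x :* (y :* z) := y :* (x :* z)) refl (ι a) (ι (m !)) (invFact m) ⟩
  ι (m !) * (ι a * invFact m)            ∎)
  where open ≡-Reasoning
        open ℚS

-- The coefficients of 1 / (1 + t), the derivative of ln (1 + t).
altSign : ℕ → ℚ
altSign zero    = 1ℚ
altSign (suc m) = - altSign m

-- The parity test inside logCoeff is local and carries its argument as a
-- hidden parameter; abstracting that parameter as M exposes the recursion.
mutual
  logSign : ℕ → ℕ → ℚ
  logSign = _

  logCoeff-unfold : ∀ m → logCoeff (3 ℕ.+ m) ≡ logSign (2 ℕ.+ m) m
  logCoeff-unfold m with suc (suc m)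
  ... | M = refl

-- `M` holds the denominator fixed while the parity argument `m` descends in steps of two.
ι*logSign : ∀ M m → ι (suc M) * logSign M m ≡ altSign m
ι*logSign M zero          = ι*/ M (ℤ.+ 1)
ι*logSign M (suc zero)    = ι*/ M -[1+ 0 ]
ι*logSign M (suc (suc m)) = trans (ι*logSign M m) (sym (⁻¹-involutive (altSign m)))

logCoeff-suc : ∀ m → ι (suc m) * logCoeff (suc m) ≡ altSign m
logCoeff-suc zero          = refl
logCoeff-suc (suc zero)    = refl
logCoeff-suc (suc (suc m)) = trans (cong (ι (3 ℕ.+ m) *_) (logCoeff-unfold m))
  (trans (ι*logSign (2 ℕ.+ m) m) (sym (⁻¹-involutive (altSign m))))

-- Finite sums of rationals.

sum-cong : ∀ n {f g : ℕ → ℚ} → (∀ a → a ≤ n → f a ≡ g a) → sumTo n f ≡ sumTo n g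
sum-cong zero    e = e 0 z≤n
sum-cong (suc n) e = cong₂ _+_ (sum-cong n (λ a a≤n → e a (ℕₚ.m≤n⇒m≤1+n a≤n))) (e (suc n) ℕₚ.≤-refl)

sum-head : ∀ n (f : ℕ → ℚ) → sumTo (suc n) f ≡ f 0 + sumTo n (f ∘ suc)
sum-head zero    f = refl
sum-head (suc n) f = trans (cong (_+ f (suc (suc n))) (sum-head n f)) (Qₚ.+-assoc (f 0) _ _)

sum-+ : ∀ n (f g : ℕ → ℚ) → sumTo n (λ a → f a + g a) ≡ sumTo n f + sumTo n g
sum-+ zero    f g = refl
sum-+ (suc n) f g = trans (cong (_+ (f (suc n) + g (suc n))) (sum-+ n f g))
  (solve 4 (λ a b c d → (a :+ b) :+ (c :+ d) := (a :+ c) :+ (b :+ d)) refl (sumTo n f) (sumTo n g) (f (suc n)) (g (suc n)))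
  where open ℚS

sum-*ˡ : ∀ n c (f : ℕ → ℚ) → c * sumTo n f ≡ sumTo n (λ a → c * f a)
sum-*ˡ zero    c f = refl
sum-*ˡ (suc n) c f = trans (Qₚ.*-distribˡ-+ c _ _) (cong (_+ c * f (suc n)) (sum-*ˡ n c f))

sum-0 : ∀ n {f : ℕ → ℚ} → (∀ a → a ≤ n → f a ≡ 0ℚ) → sumTo n f ≡ 0ℚ
sum-0 zero    e = e 0 z≤n
sum-0 (suc n) e = cong₂ _+_ (sum-0 n (λ a a≤n → e a (ℕₚ.m≤n⇒m≤1+n a≤n))) (e (suc n) ℕₚ.≤-refl)

sum-extend : ∀ {n m} {f : ℕ → ℚ} → n ≤ m → (∀ a → n < a → f a ≡ 0ℚ) → sumTo m f ≡ sumTo n f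
sum-extend {n} {zero}  z≤n e = refl
sum-extend {n} {suc m} {f} n≤m e with ℕₚ.m≤n⇒m<n∨m≡n n≤m
... | inj₂ refl      = refl
... | inj₁ (s≤s n≤m′) = trans (cong₂ _+_ (sum-extend n≤m′ e) (e (suc m) (s≤s n≤m′))) (Qₚ.+-identityʳ _)

sum-single : ∀ n {f : ℕ → ℚ} → (∀ a → f (suc a) ≡ 0ℚ) → sumTo n f ≡ f 0
sum-single n {f} e = sum-extend {0} {n} {f} z≤n (λ { (suc a) _ → e a })

-- Power series in one variable over a commutative ring.

module PowerSeries {c ℓ} (R : CommutativeRing c ℓ) where

  private module R = CommutativeRing R
  open import Relation.Binary.Reasoning.Setoid R.setoid
  open NatSolver R.commutativeSemiring

  Series : Set c
  Series = ℕ → R.Carrier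

  infixl 7 _⊛_
  -- The Cauchy product by recursion on the index, peeling off the constant term of `f`; the ring
  -- laws then follow by induction, without reindexing double sums.
  _⊛_ : Series → Series → Series
  (f ⊛ g) zero    = f 0 R.* g 0
  (f ⊛ g) (suc n) = f 0 R.* g (suc n) R.+ (f ∘ suc ⊛ g) n

  one : Series
  one zero    = R.1#
  one (suc _) = R.0#

  infix 4 _≐_
  _≐_ : Series → Series → Set ℓ
  f ≐ g = ∀ n → f n R.≈ g n

  ⊛-cong : ∀ {f f′ g g′} → f ≐ f′ → g ≐ g′ → f ⊛ g ≐ f′ ⊛ g′
  ⊛-cong p q zero    = R.*-cong (p 0) (q 0)
  ⊛-cong p q (suc n) = R.+-cong (R.*-cong (p 0) (q (suc n))) (⊛-cong (p ∘ suc) q n)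

  -- Peeling off the constant term of the other factor is what commutativity needs.
  ⊛-suc : ∀ f g n → (f ⊛ g) (suc n) R.≈ (f ⊛ g ∘ suc) n R.+ f (suc n) R.* g 0
  ⊛-suc f g zero    = R.refl
  ⊛-suc f g (suc n) = begin
    f 0 R.* g (suc (suc n)) R.+ (f ∘ suc ⊛ g) (suc n)
      ≈⟨ R.+-congˡ (⊛-suc (f ∘ suc) g n) ⟩
    f 0 R.* g (suc (suc n)) R.+ ((f ∘ suc ⊛ g ∘ suc) n R.+ f (suc (suc n)) R.* g 0)
      ≈⟨ R.sym (R.+-assoc _ _ _) ⟩
    f 0 R.* g (suc (suc n)) R.+ (f ∘ suc ⊛ g ∘ suc) n R.+ f (suc (suc n)) R.* g 0 ∎

  ⊛-comm : ∀ f g → f ⊛ g ≐ g ⊛ f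
  ⊛-comm f g zero    = R.*-comm (f 0) (g 0)
  ⊛-comm f g (suc n) = begin
    f 0 R.* g (suc n) R.+ (f ∘ suc ⊛ g) n ≈⟨ R.+-cong (R.*-comm _ _) (⊛-comm (f ∘ suc) g n) ⟩
    g (suc n) R.* f 0 R.+ (g ⊛ f ∘ suc) n ≈⟨ R.+-comm _ _ ⟩
    (g ⊛ f ∘ suc) n R.+ g (suc n) R.* f 0 ≈⟨ R.sym (⊛-suc g f n) ⟩
    (g ⊛ f) (suc n)                       ∎

  ⊛-distribʳ : ∀ h f g → (λ n → f n R.+ g n) ⊛ h ≐ (λ n → (f ⊛ h) n R.+ (g ⊛ h) n)
  ⊛-distribʳ h f g zero    = R.distribʳ _ _ _
  ⊛-distribʳ h f g (suc n) = begin
    (f 0 R.+ g 0) R.* h (suc n) R.+ ((λ m → f (suc m) R.+ g (suc m)) ⊛ h) n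
      ≈⟨ R.+-congˡ (⊛-distribʳ h (f ∘ suc) (g ∘ suc) n) ⟩
    (f 0 R.+ g 0) R.* h (suc n) R.+ ((f ∘ suc ⊛ h) n R.+ (g ∘ suc ⊛ h) n)
      ≈⟨ solve 5 (λ a b c d e → (a :+ b) :* c :+ (d :+ e) := (a :* c :+ d) :+ (b :* c :+ e)) R.refl
           (f 0) (g 0) (h (suc n)) ((f ∘ suc ⊛ h) n) ((g ∘ suc ⊛ h) n) ⟩
    (f ⊛ h) (suc n) R.+ (g ⊛ h) (suc n) ∎

  ⊛-scaleˡ : ∀ a f g → (λ n → a R.* f n) ⊛ g ≐ (λ n → a R.* (f ⊛ g) n)
  ⊛-scaleˡ a f g zero    = R.*-assoc _ _ _
  ⊛-scaleˡ a f g (suc n) = begin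
    a R.* f 0 R.* g (suc n) R.+ ((λ m → a R.* f (suc m)) ⊛ g) n
      ≈⟨ R.+-cong (R.*-assoc _ _ _) (⊛-scaleˡ a (f ∘ suc) g n) ⟩
    a R.* (f 0 R.* g (suc n)) R.+ a R.* (f ∘ suc ⊛ g) n
      ≈⟨ R.sym (R.distribˡ _ _ _) ⟩
    a R.* (f ⊛ g) (suc n) ∎

  ⊛-assoc : ∀ f g h → (f ⊛ g) ⊛ h ≐ f ⊛ (g ⊛ h)
  ⊛-assoc f g h zero    = R.*-assoc _ _ _
  ⊛-assoc f g h (suc n) = begin
    f 0 R.* g 0 R.* h (suc n) R.+ ((λ m → f 0 R.* g (suc m) R.+ (f ∘ suc ⊛ g) m) ⊛ h) n
      ≈⟨ R.+-congˡ (R.trans (⊛-distribʳ h _ _ n) (R.+-cong (⊛-scaleˡ (f 0) (g ∘ suc) h n) (⊛-assoc (f ∘ suc) g h n))) ⟩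
    f 0 R.* g 0 R.* h (suc n) R.+ (f 0 R.* (g ∘ suc ⊛ h) n R.+ (f ∘ suc ⊛ (g ⊛ h)) n)
      ≈⟨ solve 5 (λ a b c d e → a :* b :* c :+ (a :* d :+ e) := a :* (b :* c :+ d) :+ e) R.refl
           (f 0) (g 0) (h (suc n)) ((g ∘ suc ⊛ h) n) ((f ∘ suc ⊛ (g ⊛ h)) n) ⟩
    f 0 R.* (g ⊛ h) (suc n) R.+ (f ∘ suc ⊛ (g ⊛ h)) n ∎

  ⊛-zeroˡ : ∀ g n → ((λ _ → R.0#) ⊛ g) n R.≈ R.0#
  ⊛-zeroˡ g zero    = R.zeroˡ _
  ⊛-zeroˡ g (suc n) = R.trans (R.+-cong (R.zeroˡ _) (⊛-zeroˡ g n)) (R.+-identityˡ _)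

  ⊛-identityˡ : ∀ f → one ⊛ f ≐ f
  ⊛-identityˡ f zero    = R.*-identityˡ _
  ⊛-identityˡ f (suc n) = R.trans (R.+-cong (R.*-identityˡ _) (⊛-zeroˡ f n)) (R.+-identityʳ _)

  commutativeRing : CommutativeRing c ℓ
  commutativeRing = record
    { _≈_ = _≐_
    ; _*_ = _⊛_
    ; 1#  = one
    ; isCommutativeRing = record
      { isRing = record
        { +-isAbelianGroup = Pointwise.isAbelianGroup ℕ R.+-isAbelianGroup
        ; *-cong     = ⊛-cong
        ; *-assoc    = ⊛-assoc
        ; *-identity = ⊛-identityˡ , λ f n → R.trans (⊛-comm f one n) (⊛-identityˡ f n)
        ; distrib    = (λ h f g n → R.trans (⊛-comm h _ n) (R.trans (⊛-distribʳ h f g n)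
                           (R.+-cong (⊛-comm f h n) (⊛-comm g h n))))
                     , ⊛-distribʳ
        }
      ; *-comm = ⊛-comm
      }
    }

  -- `ev` stands for taking a coefficient in the remaining variables; being additive, it passes
  -- through the convolution.
  ⊛-eval : (ev : R.Carrier → ℚ) → (∀ a b → ev (a R.+ b) ≡ ev a + ev b) →
           ∀ f g n → ev ((f ⊛ g) n) ≡ sumTo n (λ a → ev (f a R.* g (n ∸ a)))
  ⊛-eval ev ev-+ f g zero    = refl
  ⊛-eval ev ev-+ f g (suc n) = trans (ev-+ _ _)
    (trans (cong (ev (f 0 R.* g (suc n)) +_) (⊛-eval ev ev-+ (f ∘ suc) g n))
           (sym (sum-head n (λ a → ev (f a R.* g (suc n ∸ a))))))

-- Four-variable series as iterated one-variable series.

module S¹ = PowerSeries Qₚ.+-*-commutativeRing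
module S² = PowerSeries S¹.commutativeRing
module S³ = PowerSeries S².commutativeRing
module S⁴ = PowerSeries S³.commutativeRing
module R⁴ = CommutativeRing S⁴.commutativeRing

⊗≐⊛ : ∀ f g → f ⊗ g S⁴.≐ f S⁴.⊛ g
⊗≐⊛ f g n k i j = sym
  (trans (S⁴.⊛-eval (λ F → F k i j) (λ _ _ → refl) f g n) (sum-cong n λ a _ →
   trans (S³.⊛-eval (λ F → F i j) (λ _ _ → refl) (f a) (g (n ∸ a)) k) (sum-cong k λ b _ →
   trans (S².⊛-eval (λ F → F j) (λ _ _ → refl) (f a b) (g (n ∸ a) (k ∸ b)) i) (sum-cong i λ c _ →
   S¹.⊛-eval (λ F → F) (λ _ _ → refl) (f a b c) (g (n ∸ a) (k ∸ b) (i ∸ c)) j))))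

one≐oneP : S⁴.one S⁴.≐ oneP
one≐oneP zero zero zero zero       = refl
one≐oneP zero zero zero (suc j)    = refl
one≐oneP zero zero (suc i) j       = refl
one≐oneP zero (suc k) i j          = refl
one≐oneP (suc n) k i j             = refl

⊗-identityˡ : ∀ f → oneP ⊗ f S⁴.≐ f
⊗-identityˡ f = R⁴.trans (⊗≐⊛ oneP f)
  (R⁴.trans (S⁴.⊛-cong (R⁴.sym one≐oneP) (R⁴.refl {f})) (S⁴.⊛-identityˡ f))

⊗-comm : ∀ f g → f ⊗ g S⁴.≐ g ⊗ f
⊗-comm f g = R⁴.trans (⊗≐⊛ f g) (R⁴.trans (S⁴.⊛-comm f g) (R⁴.sym (⊗≐⊛ g f)))

⊗-distribʳ : ∀ h f g → (f ⊕ g) ⊗ h S⁴.≐ f ⊗ h ⊕ g ⊗ h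
⊗-distribʳ h f g = R⁴.trans (⊗≐⊛ (f ⊕ g) h)
  (R⁴.trans (S⁴.⊛-distribʳ h f g) (R⁴.sym (R⁴.+-cong (⊗≐⊛ f h) (⊗≐⊛ g h))))

-- The laws are transported along `⊗≐⊛`, keeping `_⊗_` itself as the multiplication, so that they
-- apply verbatim to `rhsA`.
⊗-commutativeRing : CommutativeRing _ _
⊗-commutativeRing = record
  { Carrier = PS
  ; _≈_ = S⁴._≐_
  ; _+_ = _⊕_
  ; _*_ = _⊗_
  ; -_  = R⁴.-_
  ; 0#  = R⁴.0#
  ; 1#  = oneP
  ; isCommutativeRing = record
    { isRing = record
      { +-isAbelianGroup = R⁴.+-isAbelianGroup
      ; *-cong     = λ {f} {f′} {g} {g′} p q → R⁴.trans (⊗≐⊛ f g) (R⁴.trans (S⁴.⊛-cong p q) (R⁴.sym (⊗≐⊛ f′ g′)))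
      ; *-assoc    = λ f g h → R⁴.trans (⊗≐⊛ (f ⊗ g) h) (R⁴.trans (S⁴.⊛-cong (⊗≐⊛ f g) (R⁴.refl {h}))
                       (R⁴.trans (S⁴.⊛-assoc f g h) (R⁴.sym
                         (R⁴.trans (⊗≐⊛ f (g ⊗ h)) (S⁴.⊛-cong (R⁴.refl {f}) (⊗≐⊛ g h))))))
      ; *-identity = ⊗-identityˡ , λ f → R⁴.trans (⊗-comm f oneP) (⊗-identityˡ f)
      ; distrib    = (λ h f g → R⁴.trans (⊗-comm h (f ⊕ g)) (R⁴.trans (⊗-distribʳ h f g)
                         (R⁴.+-cong (⊗-comm f h) (⊗-comm g h))))
                   , ⊗-distribʳ
      }
    ; *-comm = ⊗-comm
    }
  }

module P = CommutativeRing ⊗-commutativeRing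
module PS-Solver = NatSolver P.commutativeSemiring

infix 4 _≈_
_≈_ : PS → PS → Set
_≈_ = P._≈_

sum⁴ : (n k i j : ℕ) → (ℕ → ℕ → ℕ → ℕ → ℚ) → ℚ
sum⁴ n k i j F = sumTo n λ a → sumTo k λ b → sumTo i λ c → sumTo j λ d → F a b c d

sum⁴-cong : ∀ n k i j {F G : ℕ → ℕ → ℕ → ℕ → ℚ} →
            (∀ {a b c d} → a ≤ n → b ≤ k → c ≤ i → d ≤ j → F a b c d ≡ G a b c d) →
            sum⁴ n k i j F ≡ sum⁴ n k i j G
sum⁴-cong n k i j e = sum-cong n λ _ p → sum-cong k λ _ q → sum-cong i λ _ r → sum-cong j λ _ s → e p q r s

sum⁴-0 : ∀ n k i j {F : ℕ → ℕ → ℕ → ℕ → ℚ} →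
         (∀ {a b c d} → a ≤ n → b ≤ k → c ≤ i → d ≤ j → F a b c d ≡ 0ℚ) → sum⁴ n k i j F ≡ 0ℚ
sum⁴-0 n k i j e = sum-0 n λ _ p → sum-0 k λ _ q → sum-0 i λ _ r → sum-0 j λ _ s → e p q r s

sum⁴-+ : ∀ n k i j (F G : ℕ → ℕ → ℕ → ℕ → ℚ) →
         sum⁴ n k i j (λ a b c d → F a b c d + G a b c d) ≡ sum⁴ n k i j F + sum⁴ n k i j G
sum⁴-+ n k i j F G =
  trans (sum-cong n λ a _ →
    trans (sum-cong k λ b _ →
      trans (sum-cong i λ c _ → sum-+ j (F a b c) (G a b c)) (sum-+ i _ _))
    (sum-+ k _ _))
  (sum-+ n _ _)

sum⁴-*ˡ : ∀ n k i j x (F : ℕ → ℕ → ℕ → ℕ → ℚ) →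
          x * sum⁴ n k i j F ≡ sum⁴ n k i j (λ a b c d → x * F a b c d)
sum⁴-*ˡ n k i j x F =
  trans (sum-*ˡ n x _) (sum-cong n λ a _ →
  trans (sum-*ˡ k x _) (sum-cong k λ b _ →
  trans (sum-*ˡ i x _) (sum-cong i λ c _ → sum-*ˡ j x (F a b c))))

·-cong : ∀ x {f g} → f ≈ g → x · f ≈ x · g
·-cong x e n k i j = cong (x *_) (e n k i j)

·-⊗ˡ : ∀ x f g → (x · f) ⊗ g ≈ x · (f ⊗ g)
·-⊗ˡ x f g n k i j = sym (trans (sum⁴-*ˡ n k i j x _)
  (sum⁴-cong n k i j λ {a} {b} {c} {d} _ _ _ _ → sym (Qₚ.*-assoc x (f a b c d) _)))

·-⊗ʳ : ∀ x f g → f ⊗ (x · g) ≈ x · (f ⊗ g)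
·-⊗ʳ x f g = P.trans (P.*-comm f (x · g)) (P.trans (·-⊗ˡ x g f) (·-cong x (P.*-comm g f)))

-- Additive weights, order of a series, and composition c(f).

Weight : Set
Weight = ℕ → ℕ → ℕ → ℕ → ℕ

-- Additivity over every splitting of an exponent is what gives `θ` the Leibniz rule; the bounds
-- make the truncated differences genuine.
Additive : Weight → Set
Additive ω = ∀ {n k i j a b c d} → a ≤ n → b ≤ k → c ≤ i → d ≤ j →
             ω a b c d ℕ.+ ω (n ∸ a) (k ∸ b) (i ∸ c) (j ∸ d) ≡ ω n k i j

degree zDegree yDegree : Weight
degree  n k i j = n ℕ.+ k ℕ.+ i ℕ.+ j
zDegree n k i j = n
yDegree n k i j = j

degree-additive : Additive degree
degree-additive {n} {k} {i} {j} {a} {b} {c} {d} a≤n b≤k c≤i d≤j = begin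
  a ℕ.+ b ℕ.+ c ℕ.+ d ℕ.+ (n ∸ a ℕ.+ (k ∸ b) ℕ.+ (i ∸ c) ℕ.+ (j ∸ d))
    ≡⟨ solve 8 (λ a b c d e f g h → (a :+ b :+ c :+ d) :+ (e :+ f :+ g :+ h) :=
                                    (a :+ e) :+ (b :+ f) :+ (c :+ g) :+ (d :+ h)) refl
         a b c d (n ∸ a) (k ∸ b) (i ∸ c) (j ∸ d) ⟩
  (a ℕ.+ (n ∸ a)) ℕ.+ (b ℕ.+ (k ∸ b)) ℕ.+ (c ℕ.+ (i ∸ c)) ℕ.+ (d ℕ.+ (j ∸ d))
    ≡⟨ cong₂ ℕ._+_ (cong₂ ℕ._+_ (cong₂ ℕ._+_ (ℕₚ.m+[n∸m]≡n a≤n) (ℕₚ.m+[n∸m]≡n b≤k))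
         (ℕₚ.m+[n∸m]≡n c≤i)) (ℕₚ.m+[n∸m]≡n d≤j) ⟩
  n ℕ.+ k ℕ.+ i ℕ.+ j ∎
  where open ≡-Reasoning
        open +-*-Solver

zDegree-additive : Additive zDegree
zDegree-additive a≤n _ _ _ = ℕₚ.m+[n∸m]≡n a≤n

yDegree-additive : Additive yDegree
yDegree-additive _ _ _ d≤j = ℕₚ.m+[n∸m]≡n d≤j

VanishesBelow : ℕ → PS → Set
VanishesBelow p f = ∀ n k i j → degree n k i j < p → f n k i j ≡ 0ℚ

vanishesBelow-1 : ∀ {f} → f 0 0 0 0 ≡ 0ℚ → VanishesBelow 1 f
vanishesBelow-1 e zero    zero    zero    zero    _ = e
vanishesBelow-1 e zero    zero    zero    (suc j) (s≤s ())
vanishesBelow-1 e zero    zero    (suc i) j       (s≤s ())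
vanishesBelow-1 e zero    (suc k) i       j       (s≤s ())
vanishesBelow-1 e (suc n) k       i       j       (s≤s ())

vanishesBelow-⊗ : ∀ {f g m} → VanishesBelow 1 f → VanishesBelow m g → VanishesBelow (suc m) (f ⊗ g)
vanishesBelow-⊗ {f} {g} {m} vf vg n k i j (s≤s N≤m) = sum⁴-0 n k i j term
  where
  term : ∀ {a b c d} → a ≤ n → b ≤ k → c ≤ i → d ≤ j → f a b c d * g (n ∸ a) (k ∸ b) (i ∸ c) (j ∸ d) ≡ 0ℚ
  term {a} {b} {c} {d} p q r s with degree a b c d ℕ.<? 1
  ... | yes lt = trans (cong (_* g (n ∸ a) (k ∸ b) (i ∸ c) (j ∸ d)) (vf a b c d lt)) (Qₚ.*-zeroˡ (g (n ∸ a) (k ∸ b) (i ∸ c) (j ∸ d)))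
  ... | no ≮1 = trans (cong (f a b c d *_) (vg _ _ _ _ rest<m)) (Qₚ.*-zeroʳ (f a b c d))
    where
    rest<m : degree (n ∸ a) (k ∸ b) (i ∸ c) (j ∸ d) < m
    rest<m = ℕₚ.≤-trans (ℕₚ.≤-trans (ℕₚ.+-monoˡ-≤ _ (ℕₚ.≮⇒≥ ≮1)) (ℕₚ.≤-reflexive (degree-additive {n} {k} {i} {j} p q r s))) N≤m

vanishesBelow-^ : ∀ {f} → VanishesBelow 1 f → ∀ m → VanishesBelow m (f ^P m)
vanishesBelow-^ vf zero    n k i j ()
vanishesBelow-^ {f} vf (suc m) = vanishesBelow-⊗ {f} {f ^P m} vf (vanishesBelow-^ {f} vf m)

-- The coefficients of `g` that enter have degree at most that of the target. This permits replacing
-- a moving cutoff by a fixed one.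
⊗-local : ∀ f {g h} n k i j →
          (∀ a b c d → degree a b c d ≤ degree n k i j → g a b c d ≡ h a b c d) →
          (f ⊗ g) n k i j ≡ (f ⊗ h) n k i j
⊗-local f n k i j e = sum⁴-cong n k i j λ {a} {b} {c} {d} p q r s →
  cong (f a b c d *_) (e _ _ _ _ (ℕₚ.m+n≤o⇒n≤o (degree a b c d) (ℕₚ.≤-reflexive (degree-additive {n} {k} {i} {j} p q r s))))

-- The common form of the three series operations: `expP` and `lnP` are instances by definition,
-- `invP` is one up to factors `1ℚ`.
comp : (ℕ → ℚ) → PS → PS
comp c f n k i j = sumTo (degree n k i j) λ m → c m * (f ^P m) n k i j

-- Its cutoff does not depend on the coefficient, so it is a finite sum of series and products
-- distribute over it.
partialComp : ℕ → (ℕ → ℚ) → PS → PS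
partialComp M c f n k i j = sumTo M λ m → c m * (f ^P m) n k i j

partialComp≡comp : ∀ {f} → VanishesBelow 1 f → ∀ c M n k i j → degree n k i j ≤ M →
                   partialComp M c f n k i j ≡ comp c f n k i j
partialComp≡comp {f} vf c M n k i j N≤M = sum-extend N≤M λ m N<m →
  trans (cong (c m *_) (vanishesBelow-^ {f} vf m n k i j N<m)) (Qₚ.*-zeroʳ (c m))

⊗-partialComp : ∀ M g c f n k i j →
                (g ⊗ partialComp M c f) n k i j ≡ sumTo M λ m → c m * (g ⊗ f ^P m) n k i j
⊗-partialComp zero    g c f n k i j = ·-⊗ʳ (c 0) g (f ^P 0) n k i j
⊗-partialComp (suc M) g c f n k i j =
  trans (P.distribˡ g (partialComp M c f) (c (suc M) · f ^P suc M) n k i j)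
        (cong₂ _+_ (⊗-partialComp M g c f n k i j) (·-⊗ʳ (c (suc M)) g (f ^P suc M) n k i j))

⊗-comp : ∀ {f} → VanishesBelow 1 f → ∀ g c n k i j →
         (g ⊗ comp c f) n k i j ≡ sumTo (degree n k i j) λ m → c m * (g ⊗ f ^P m) n k i j
⊗-comp {f} vf g c n k i j =
  trans (⊗-local g n k i j (λ a b c′ d N≤ → sym (partialComp≡comp {f} vf c _ a b c′ d N≤)))
        (⊗-partialComp (degree n k i j) g c f n k i j)

-- Horner's rule. A vanishing top term is added first, so that splitting off the head leaves the
-- right cutoff.
comp-unfold : ∀ {f} → VanishesBelow 1 f → ∀ c → comp c f ≈ c 0 · oneP ⊕ f ⊗ comp (c ∘ suc) f
comp-unfold {f} vf c n k i j = begin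
  comp c f n k i j
    ≡⟨ partialComp≡comp {f} vf c _ n k i j (ℕₚ.n≤1+n _) ⟨
  partialComp (suc (degree n k i j)) c f n k i j
    ≡⟨ sum-head (degree n k i j) _ ⟩
  c 0 * oneP n k i j + sumTo (degree n k i j) (λ m → c (suc m) * (f ⊗ f ^P m) n k i j)
    ≡⟨ cong (c 0 * oneP n k i j +_) (⊗-comp {f} vf f (c ∘ suc) n k i j) ⟨
  (c 0 · oneP ⊕ f ⊗ comp (c ∘ suc) f) n k i j ∎
  where open ≡-Reasoning

-- Euler operators: zDegree gives z∂/∂z and yDegree gives y∂/∂y, without any shift of the index.
θ : Weight → PS → PS
θ ω f n k i j = ι (ω n k i j) * f n k i j

θ-cong : ∀ ω {f g} → f ≈ g → θ ω f ≈ θ ω g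
θ-cong ω e n k i j = cong (ι (ω n k i j) *_) (e n k i j)

θ-⊕ : ∀ ω f g → θ ω (f ⊕ g) ≈ θ ω f ⊕ θ ω g
θ-⊕ ω f g n k i j = Qₚ.*-distribˡ-+ (ι (ω n k i j)) _ _

module Derivation {ω : Weight} (additive : Additive ω) where

  θ-⊗ : ∀ f g → θ ω (f ⊗ g) ≈ θ ω f ⊗ g ⊕ f ⊗ θ ω g
  θ-⊗ f g n k i j = begin
    ι (ω n k i j) * (f ⊗ g) n k i j
      ≡⟨ sum⁴-*ˡ n k i j (ι (ω n k i j)) _ ⟩
    sum⁴ n k i j (λ a b c d → ι (ω n k i j) * (f a b c d * g (n ∸ a) (k ∸ b) (i ∸ c) (j ∸ d)))
      ≡⟨ sum⁴-cong n k i j split ⟩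
    sum⁴ n k i j (λ a b c d → θ ω f a b c d * g (n ∸ a) (k ∸ b) (i ∸ c) (j ∸ d)
                            + f a b c d * θ ω g (n ∸ a) (k ∸ b) (i ∸ c) (j ∸ d))
      ≡⟨ sum⁴-+ n k i j _ _ ⟩
    (θ ω f ⊗ g ⊕ f ⊗ θ ω g) n k i j ∎
    where
    open ≡-Reasoning
    open ℚS
    split : ∀ {a b c d} → a ≤ n → b ≤ k → c ≤ i → d ≤ j →
            ι (ω n k i j) * (f a b c d * g (n ∸ a) (k ∸ b) (i ∸ c) (j ∸ d)) ≡
            θ ω f a b c d * g (n ∸ a) (k ∸ b) (i ∸ c) (j ∸ d) + f a b c d * θ ω g (n ∸ a) (k ∸ b) (i ∸ c) (j ∸ d)
    split {a} {b} {c} {d} p q r s =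
      trans (cong (_* (f a b c d * g (n ∸ a) (k ∸ b) (i ∸ c) (j ∸ d)))
              (trans (cong ι (sym (additive {n} {k} {i} {j} p q r s))) (ι-+ (ω a b c d) _)))
            (solve 4 (λ w w′ x y → (w :+ w′) :* (x :* y) := (w :* x) :* y :+ x :* (w′ :* y)) refl
              (ι (ω a b c d)) (ι (ω (n ∸ a) (k ∸ b) (i ∸ c) (j ∸ d))) (f a b c d) (g (n ∸ a) (k ∸ b) (i ∸ c) (j ∸ d)))

  ω-0 : ω 0 0 0 0 ≡ 0
  ω-0 = ℕₚ.+-cancelˡ-≡ (ω 0 0 0 0) (ω 0 0 0 0) 0
    (trans (additive {0} {0} {0} {0} z≤n z≤n z≤n z≤n) (sym (ℕₚ.+-identityʳ _)))

  θ-one : θ ω oneP ≈ P.0#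
  θ-one zero zero zero zero    = cong (λ w → ι w * 1ℚ) ω-0
  θ-one zero zero zero (suc j) = Qₚ.*-zeroʳ (ι (ω 0 0 0 (suc j)))
  θ-one zero zero (suc i) j    = Qₚ.*-zeroʳ (ι (ω 0 0 (suc i) j))
  θ-one zero (suc k) i j       = Qₚ.*-zeroʳ (ι (ω 0 (suc k) i j))
  θ-one (suc n) k i j          = Qₚ.*-zeroʳ (ι (ω (suc n) k i j))

  θ-^ : ∀ f m → θ ω (f ^P suc m) ≈ ι (suc m) · (θ ω f ⊗ f ^P m)
  θ-^ f zero n k i j = begin
    θ ω (f ⊗ oneP) n k i j                       ≡⟨ θ-⊗ f oneP n k i j ⟩
    (θ ω f ⊗ oneP) n k i j + (f ⊗ θ ω oneP) n k i j
      ≡⟨ cong ((θ ω f ⊗ oneP) n k i j +_) (P.trans (P.*-congˡ {f} θ-one) (P.zeroʳ f) n k i j) ⟩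
    (θ ω f ⊗ oneP) n k i j + 0ℚ                  ≡⟨ Qₚ.+-identityʳ _ ⟩
    (θ ω f ⊗ oneP) n k i j                       ≡⟨ Qₚ.*-identityˡ _ ⟨
    1ℚ * (θ ω f ⊗ oneP) n k i j                  ∎
    where open ≡-Reasoning
  θ-^ f (suc m) n k i j = begin
    θ ω (f ⊗ f ^P suc m) n k i j
      ≡⟨ θ-⊗ f (f ^P suc m) n k i j ⟩
    (θ ω f ⊗ f ^P suc m) n k i j + (f ⊗ θ ω (f ^P suc m)) n k i j
      ≡⟨ cong ((θ ω f ⊗ f ^P suc m) n k i j +_) (trans (P.*-congˡ {f} (θ-^ f m) n k i j)
           (·-⊗ʳ (ι (suc m)) f (θ ω f ⊗ f ^P m) n k i j)) ⟩
    (θ ω f ⊗ f ^P suc m) n k i j + ι (suc m) * (f ⊗ (θ ω f ⊗ f ^P m)) n k i j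
      ≡⟨ cong (λ t → (θ ω f ⊗ f ^P suc m) n k i j + ι (suc m) * t)
           (solve 3 (λ x y z → x :* (y :* z) := y :* (x :* z)) P.refl f (θ ω f) (f ^P m) n k i j) ⟩
    (θ ω f ⊗ f ^P suc m) n k i j + ι (suc m) * (θ ω f ⊗ f ^P suc m) n k i j
      ≡⟨ cong (_+ ι (suc m) * (θ ω f ⊗ f ^P suc m) n k i j) (sym (Qₚ.*-identityˡ ((θ ω f ⊗ f ^P suc m) n k i j))) ⟩
    1ℚ * (θ ω f ⊗ f ^P suc m) n k i j + ι (suc m) * (θ ω f ⊗ f ^P suc m) n k i j
      ≡⟨ Qₚ.*-distribʳ-+ _ 1ℚ (ι (suc m)) ⟨
    ι (suc (suc m)) * (θ ω f ⊗ f ^P suc m) n k i j ∎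
    where open ≡-Reasoning
          open PS-Solver

  -- The chain rule: `ι (suc m) * c (suc m)` are the coefficients of the derivative of c.
  θ-comp : ∀ {f} → VanishesBelow 1 f → ∀ c →
           θ ω (comp c f) ≈ θ ω f ⊗ comp (λ m → ι (suc m) * c (suc m)) f
  θ-comp {f} vf c n k i j = begin
    w * comp c f n k i j
      -- Differentiation lowers the power by one, so the cutoff is raised beforehand.
      ≡⟨ cong (w *_) (sym (partialComp≡comp {f} vf c _ n k i j (ℕₚ.n≤1+n N))) ⟩
    w * sumTo (suc N) (λ m → c m * (f ^P m) n k i j)
      ≡⟨ sum-*ˡ (suc N) w _ ⟩
    sumTo (suc N) (λ m → w * (c m * (f ^P m) n k i j))
      ≡⟨ sum-head N _ ⟩
    w * (c 0 * oneP n k i j) + sumTo N (λ m → w * (c (suc m) * (f ^P suc m) n k i j))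
      ≡⟨ cong₂ _+_ first (sum-cong N rest) ⟩
    0ℚ + sumTo N (λ m → ι (suc m) * c (suc m) * (θ ω f ⊗ f ^P m) n k i j)
      ≡⟨ Qₚ.+-identityˡ _ ⟩
    sumTo N (λ m → ι (suc m) * c (suc m) * (θ ω f ⊗ f ^P m) n k i j)
      ≡⟨ ⊗-comp {f} vf (θ ω f) (λ m → ι (suc m) * c (suc m)) n k i j ⟨
    (θ ω f ⊗ comp (λ m → ι (suc m) * c (suc m)) f) n k i j ∎
    where
    open ≡-Reasoning
    open ℚS
    w = ι (ω n k i j)
    N = degree n k i j
    swap : ∀ x y z → x * (y * z) ≡ y * (x * z)
    swap = solve 3 (λ x y z → x :* (y :* z) := y :* (x :* z)) refl
    first : w * (c 0 * oneP n k i j) ≡ 0ℚ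
    first = trans (swap w (c 0) _) (trans (cong (c 0 *_) (θ-one n k i j)) (Qₚ.*-zeroʳ (c 0)))
    rest : ∀ m → m ≤ N → w * (c (suc m) * (f ^P suc m) n k i j) ≡ ι (suc m) * c (suc m) * (θ ω f ⊗ f ^P m) n k i j
    rest m _ = trans (swap w (c (suc m)) _) (trans (cong (c (suc m) *_) (θ-^ f m n k i j))
      (trans (swap (c (suc m)) (ι (suc m)) _) (sym (Qₚ.*-assoc (ι (suc m)) (c (suc m)) _))))

-- Series divisible by z.

VanishesAtZ0 : PS → Set
VanishesAtZ0 f = ∀ k i j → f 0 k i j ≡ 0ℚ

vanishesAtZ0-⊗ˡ : ∀ {f} g → VanishesAtZ0 f → VanishesAtZ0 (f ⊗ g)
vanishesAtZ0-⊗ˡ {f} g v k i j = sum⁴-0 0 k i j λ {a} {b} {c} {d} a≤0 _ _ _ → term a≤0 b c d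
  where
  term : ∀ {a} → a ≤ 0 → ∀ b c d → f a b c d * g (0 ∸ a) (k ∸ b) (i ∸ c) (j ∸ d) ≡ 0ℚ
  term z≤n b c d = trans (cong (_* g 0 (k ∸ b) (i ∸ c) (j ∸ d)) (v b c d)) (Qₚ.*-zeroˡ (g 0 (k ∸ b) (i ∸ c) (j ∸ d)))

vanishesAtZ0-≈ : ∀ {f g : PS} → f ≈ g → VanishesAtZ0 f → VanishesAtZ0 g
vanishesAtZ0-≈ e v k i j = trans (sym (e 0 k i j)) (v k i j)

vanishesAtZ0-⊗ʳ : ∀ f {g} → VanishesAtZ0 g → VanishesAtZ0 (f ⊗ g)
vanishesAtZ0-⊗ʳ f {g} v = vanishesAtZ0-≈ {g ⊗ f} {f ⊗ g} (P.*-comm g f) (vanishesAtZ0-⊗ˡ {g} f v)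

vanishesAtZ0-⊕ : ∀ {f g : PS} → VanishesAtZ0 f → VanishesAtZ0 g → VanishesAtZ0 (f ⊕ g)
vanishesAtZ0-⊕ v w k i j = cong₂ _+_ (v k i j) (w k i j)

atZ0⇒below-1 : ∀ {f} → VanishesAtZ0 f → VanishesBelow 1 f
atZ0⇒below-1 {f} v = vanishesBelow-1 {f} (v 0 0 0)

-- By Horner's rule all but the constant term has a factor `f`. This gives the initial values at z =
-- 0.
comp-atZ0 : ∀ {f} → VanishesAtZ0 f → ∀ c k i j → comp c f 0 k i j ≡ c 0 * oneP 0 k i j
comp-atZ0 {f} v c k i j =
  trans (comp-unfold {f} (atZ0⇒below-1 {f} v) c 0 k i j)
        (trans (cong (c 0 * oneP 0 k i j +_) (vanishesAtZ0-⊗ˡ {f} (comp (c ∘ suc) f) v k i j)) (Qₚ.+-identityʳ _))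

-- Inverses, exponential and logarithm.

open GroupProperties P.+-group using () renaming (∙-cancelʳ to ⊕-cancelʳ)

comp-cong : ∀ {c d} → (∀ m → c m ≡ d m) → ∀ f → comp c f ≈ comp d f
comp-cong e f n k i j = sum-cong (degree n k i j) λ m _ → cong (_* (f ^P m) n k i j) (e m)

⊖-⊕ : ∀ f g → (f ⊖ g) ⊕ g ≈ f
⊖-⊕ f g n k i j = trans (Qₚ.+-assoc (f n k i j) (- g n k i j) (g n k i j))
  (trans (cong (f n k i j +_) (Qₚ.+-inverseˡ (g n k i j))) (Qₚ.+-identityʳ _))

⊕-⊖ : ∀ f g → f ⊕ (g ⊖ f) ≈ g
⊕-⊖ f g = P.trans (P.+-comm f (g ⊖ f)) (⊖-⊕ g f)

-- Horner's rule for the geometric series reads 1/q = 1 + (1 - q)/q; cancelling the last term leaves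
-- the claim.
invP-inverse : ∀ q → (oneP ⊖ q) 0 0 0 0 ≡ 0ℚ → q ⊗ invP q ≈ oneP
invP-inverse q e = ⊕-cancelʳ (f ⊗ invP q) (q ⊗ invP q) oneP (begin
  q ⊗ invP q ⊕ f ⊗ invP q       ≈⟨ P.distribʳ (invP q) q f ⟨
  (q ⊕ f) ⊗ invP q              ≈⟨ P.*-congʳ {invP q} (⊕-⊖ q oneP) ⟩
  oneP ⊗ invP q                 ≈⟨ P.*-identityˡ (invP q) ⟩
  invP q                        ≈⟨ invP≈comp ⟩
  comp (λ _ → 1ℚ) f             ≈⟨ comp-unfold {f} (vanishesBelow-1 {f} e) (λ _ → 1ℚ) ⟩
  1ℚ · oneP ⊕ f ⊗ comp (λ _ → 1ℚ) f
    ≈⟨ P.+-cong (λ n k i j → Qₚ.*-identityˡ (oneP n k i j)) (P.*-congˡ {f} (P.sym invP≈comp)) ⟩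
  oneP ⊕ f ⊗ invP q             ∎)
  where
  open import Relation.Binary.Reasoning.Setoid P.setoid
  f = oneP ⊖ q
  invP≈comp : invP q ≈ comp (λ _ → 1ℚ) f
  invP≈comp n k i j = sum-cong (degree n k i j) λ m _ → sym (Qₚ.*-identityˡ _)

-- Shifting the alternating sequence negates it, so in Horner's rule for `s` the multiples of `f`
-- cancel.
comp-altSign-inverse : ∀ h → VanishesBelow 1 (h ⊖ oneP) → h ⊗ comp altSign (h ⊖ oneP) ≈ oneP
comp-altSign-inverse h vf = begin
  h ⊗ s             ≈⟨ P.*-congʳ {s} (⊖-⊕ h oneP) ⟨
  (f ⊕ oneP) ⊗ s    ≈⟨ P.distribʳ s f oneP ⟩
  f ⊗ s ⊕ oneP ⊗ s  ≈⟨ P.+-congˡ {f ⊗ s} (P.trans (P.*-identityˡ s) (comp-unfold {f} vf altSign)) ⟩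
  f ⊗ s ⊕ (1ℚ · oneP ⊕ f ⊗ s⁻)
    ≈⟨ solve 4 (λ f s o t → f :* s :+ (o :+ f :* t) := o :+ f :* (s :+ t)) P.refl f s (1ℚ · oneP) s⁻ ⟩
  1ℚ · oneP ⊕ f ⊗ (s ⊕ s⁻)
    ≈⟨ P.+-cong (λ n k i j → Qₚ.*-identityˡ (oneP n k i j)) (P.trans (P.*-congˡ {f} s+s⁻≈0) (P.zeroʳ f)) ⟩
  oneP ⊕ P.0#       ≈⟨ P.+-identityʳ oneP ⟩
  oneP              ∎
  where
  open import Relation.Binary.Reasoning.Setoid P.setoid
  open PS-Solver
  f = h ⊖ oneP
  s = comp altSign f
  s⁻ = comp (altSign ∘ suc) f
  s+s⁻≈0 : s ⊕ s⁻ ≈ P.0#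
  s+s⁻≈0 n k i j = trans (sym (sum-+ (degree n k i j) _ _)) (sum-0 (degree n k i j) λ m _ →
    trans (sym (Qₚ.*-distribʳ-+ ((f ^P m) n k i j) (altSign m) (- altSign m)))
    (trans (cong (_* (f ^P m) n k i j) (Qₚ.+-inverseʳ (altSign m))) (Qₚ.*-zeroˡ ((f ^P m) n k i j))))

module Calculus {ω : Weight} (additive : Additive ω) where

  open Derivation {ω} additive public
  open DifferentialRing.Rules ⊗-commutativeRing (θ ω) (θ-cong ω) (θ-⊕ ω) θ-⊗ public

  θ-exp : ∀ f → VanishesBelow 1 f → θ ω (expP f) ≈ θ ω f ⊗ expP f
  θ-exp f vf = P.trans (θ-comp {f} vf invFact) (P.*-congˡ {θ ω f} (comp-cong invFact-suc f))

  -- The chain rule produces the alternating series in h - 1, which is the inverse of `h`.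
  θ-ln : ∀ h → VanishesBelow 1 (h ⊖ oneP) → θ ω (lnP h) ⊗ h ≈ θ ω h
  θ-ln h vf = begin
    θ ω (lnP h) ⊗ h      ≈⟨ P.*-congʳ {h} (P.trans (θ-comp {f} vf logCoeff) (P.*-congˡ {θ ω f} (comp-cong logCoeff-suc f))) ⟩
    θ ω f ⊗ s ⊗ h        ≈⟨ solve 3 (λ d s h → d :* s :* h := d :* (h :* s)) P.refl (θ ω f) s h ⟩
    θ ω f ⊗ (h ⊗ s)      ≈⟨ P.*-cong θf≈θh (comp-altSign-inverse h vf) ⟩
    θ ω h ⊗ oneP         ≈⟨ P.*-identityʳ (θ ω h) ⟩
    θ ω h                ∎
    where
    open import Relation.Binary.Reasoning.Setoid P.setoid
    open PS-Solver
    f = h ⊖ oneP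
    s = comp altSign f
    θf≈θh : θ ω f ≈ θ ω h
    θf≈θh = begin
      θ ω f                ≈⟨ P.+-identityʳ (θ ω f) ⟨
      θ ω f ⊕ P.0#         ≈⟨ P.+-congˡ {θ ω f} θ-one ⟨
      θ ω f ⊕ θ ω oneP     ≈⟨ θ-⊕ ω f oneP ⟨
      θ ω (f ⊕ oneP)       ≈⟨ θ-cong ω (⊖-⊕ h oneP) ⟩
      θ ω h                ∎

θ-neg : ∀ ω f → θ ω (P.- f) ≈ P.- θ ω f
θ-neg ω f n k i j = sym (Qₚ.neg-distribʳ-* (ι (ω n k i j)) (f n k i j))

-- The series that make up the right-hand side; `F` unfolds to `rhsA`.

v e E q I h λh α W F : PS
v  = oneP ⊖ uP
e  = zP ⊗ v
E  = expP e
q  = oneP ⊖ uP ⊗ E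
I  = invP q
h  = v ⊗ I
λh = lnP h
α  = e ⊕ λh
W  = zP ⊗ yP ⊗ v ⊕ (xP ⊕ yP) ⊗ λh
F  = expP W

v⊕u≈1 : v ⊕ uP ≈ oneP
v⊕u≈1 = ⊖-⊕ oneP uP

q⊕uE≈1 : q ⊕ uP ⊗ E ≈ oneP
q⊕uE≈1 = ⊖-⊕ oneP (uP ⊗ E)

qI≈1 : q ⊗ I ≈ oneP
qI≈1 = invP-inverse q refl

vanishesAtZ0-z : VanishesAtZ0 zP
vanishesAtZ0-z k i j = refl

vanishesAtZ0-e : VanishesAtZ0 e
vanishesAtZ0-e = vanishesAtZ0-⊗ˡ {zP} v vanishesAtZ0-z

vanishesAtZ0-E⊖1 : VanishesAtZ0 (E ⊖ oneP)
vanishesAtZ0-E⊖1 k i j = trans (cong (_- oneP 0 k i j)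
  (trans (comp-atZ0 {e} vanishesAtZ0-e invFact k i j) (Qₚ.*-identityˡ (oneP 0 k i j))))
  (Qₚ.+-inverseʳ (oneP 0 k i j))

-- From h q = v and v + u = 1 = q + u E follows (h - 1) v = h u (E - 1). Since `v` is a unit, h - 1
-- is a multiple of E - 1, which is divisible by z.
vanishesAtZ0-h⊖1 : VanishesAtZ0 (h ⊖ oneP)
vanishesAtZ0-h⊖1 = vanishesAtZ0-≈ {h ⊗ uP ⊗ E₁ ⊗ invP v} {f}
  f≈ (vanishesAtZ0-⊗ˡ {h ⊗ uP ⊗ E₁} (invP v) (vanishesAtZ0-⊗ʳ (h ⊗ uP) {E₁} vanishesAtZ0-E⊖1))
  where
  open import Relation.Binary.Reasoning.Setoid P.setoid
  open PS-Solver
  f = h ⊖ oneP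
  E₁ = E ⊖ oneP
  hq≈v : h ⊗ q ≈ v
  hq≈v = begin
    v ⊗ I ⊗ q    ≈⟨ solve 3 (λ v I q → v :* I :* q := v :* (q :* I)) P.refl v I q ⟩
    v ⊗ (q ⊗ I)  ≈⟨ P.*-congˡ {v} qI≈1 ⟩
    v ⊗ oneP     ≈⟨ P.*-identityʳ v ⟩
    v            ∎
  fv≈huE₁ : f ⊗ v ≈ h ⊗ uP ⊗ E₁
  fv≈huE₁ = ⊕-cancelʳ (v ⊕ h ⊗ uP) (f ⊗ v) (h ⊗ uP ⊗ E₁) (begin
    f ⊗ v ⊕ (v ⊕ h ⊗ uP)
      ≈⟨ solve 3 (λ f v t → f :* v :+ (v :+ t) := (f :+ con 1) :* v :+ t) P.refl f v (h ⊗ uP) ⟩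
    (f ⊕ oneP) ⊗ v ⊕ h ⊗ uP
      ≈⟨ P.+-congʳ {h ⊗ uP} (P.*-congʳ {v} (⊖-⊕ h oneP)) ⟩
    h ⊗ v ⊕ h ⊗ uP          ≈⟨ P.distribˡ h v uP ⟨
    h ⊗ (v ⊕ uP)            ≈⟨ P.*-congˡ {h} (P.trans v⊕u≈1 (P.sym q⊕uE≈1)) ⟩
    h ⊗ (q ⊕ uP ⊗ E)        ≈⟨ P.distribˡ h q (uP ⊗ E) ⟩
    h ⊗ q ⊕ h ⊗ (uP ⊗ E)    ≈⟨ P.+-cong hq≈v (P.*-congˡ {h} (P.*-congˡ {uP} (P.sym (⊖-⊕ E oneP)))) ⟩
    v ⊕ h ⊗ (uP ⊗ (E₁ ⊕ oneP))
      ≈⟨ solve 5 (λ v h u E₁ o → v :+ h :* (u :* (E₁ :+ o)) := h :* u :* E₁ :+ (v :+ h :* u :* o)) P.refl v h uP E₁ oneP ⟩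
    h ⊗ uP ⊗ E₁ ⊕ (v ⊕ h ⊗ uP ⊗ oneP)
      ≈⟨ P.+-congˡ {h ⊗ uP ⊗ E₁} (P.+-congˡ {v} (P.*-identityʳ (h ⊗ uP))) ⟩
    h ⊗ uP ⊗ E₁ ⊕ (v ⊕ h ⊗ uP) ∎)
  f≈ : h ⊗ uP ⊗ E₁ ⊗ invP v ≈ f
  f≈ = begin
    h ⊗ uP ⊗ E₁ ⊗ invP v   ≈⟨ P.*-congʳ {invP v} fv≈huE₁ ⟨
    f ⊗ v ⊗ invP v         ≈⟨ P.*-assoc f v (invP v) ⟩
    f ⊗ (v ⊗ invP v)       ≈⟨ P.*-congˡ {f} (invP-inverse v refl) ⟩
    f ⊗ oneP               ≈⟨ P.*-identityʳ f ⟩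
    f                      ∎

vanishesAtZ0-λh : VanishesAtZ0 λh
vanishesAtZ0-λh k i j = trans (comp-atZ0 {h ⊖ oneP} vanishesAtZ0-h⊖1 logCoeff k i j) (Qₚ.*-zeroˡ (oneP 0 k i j))

vanishesAtZ0-α : VanishesAtZ0 α
vanishesAtZ0-α = vanishesAtZ0-⊕ {e} {λh} vanishesAtZ0-e vanishesAtZ0-λh

vanishesAtZ0-W : VanishesAtZ0 W
vanishesAtZ0-W = vanishesAtZ0-⊕ {zP ⊗ yP ⊗ v} {(xP ⊕ yP) ⊗ λh}
  (vanishesAtZ0-⊗ˡ {zP ⊗ yP} v (vanishesAtZ0-⊗ˡ {zP} yP vanishesAtZ0-z))
  (vanishesAtZ0-⊗ʳ (xP ⊕ yP) {λh} vanishesAtZ0-λh)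

F-atZ0 : ∀ k i j → F 0 k i j ≡ oneP 0 k i j
F-atZ0 k i j = trans (comp-atZ0 {W} vanishesAtZ0-W invFact k i j) (Qₚ.*-identityˡ (oneP 0 k i j))

h-s : h ⊗ comp altSign (h ⊖ oneP) ≈ oneP
h-s = comp-altSign-inverse h (atZ0⇒below-1 {h ⊖ oneP} vanishesAtZ0-h⊖1)

module SeriesCalculus {ω : Weight} (additive : Additive ω) where

  open Calculus {ω} additive public

  θE : θ ω E ≈ θ ω e ⊗ E
  θE = θ-exp e (atZ0⇒below-1 {e} vanishesAtZ0-e)

  θF : θ ω F ≈ θ ω W ⊗ F
  θF = θ-exp W (atZ0⇒below-1 {W} vanishesAtZ0-W)

  θλ⊗h : θ ω λh ⊗ h ≈ θ ω h
  θλ⊗h = θ-ln h (atZ0⇒below-1 {h ⊖ oneP} vanishesAtZ0-h⊖1)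

  -- The total degree does not annihilate `uP`, so the three rules above, which it shares, stay
  -- outside this hypothesis.
  module _ (θu≈0 : θ ω uP ≈ P.0#) where

    open Quotient {uP} {v} {e} {E} {I} {q} θu≈0 v⊕u≈1 θE q⊕uE≈1 qI≈1 public

    θλ : θ ω λh ≈ uP ⊗ I ⊗ E ⊗ θ ω e
    θλ = unit-cancelʳ {θ ω λh} {uP ⊗ I ⊗ E ⊗ θ ω e} {h} {comp altSign (h ⊖ oneP)} h-s (P.trans θλ⊗h D-quotient)

-- Euler operators in z and in y applied to the right-hand side.

θz-z : θ zDegree zP ≈ zP
θz-z zero          k       i       j       = refl
θz-z (suc zero)    zero    zero    zero    = refl
θz-z (suc zero)    zero    zero    (suc j) = refl
θz-z (suc zero)    zero    (suc i) j       = refl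
θz-z (suc zero)    (suc k) i       j       = refl
θz-z (suc (suc n)) k       i       j       = Qₚ.*-zeroʳ (ι (suc (suc n)))

θz-u : θ zDegree uP ≈ P.0#
θz-u zero    k i j = Qₚ.*-zeroˡ (uP 0 k i j)
θz-u (suc n) k i j = Qₚ.*-zeroʳ (ι (suc n))

θz-x : θ zDegree xP ≈ P.0#
θz-x zero    k i j = Qₚ.*-zeroˡ (xP 0 k i j)
θz-x (suc n) k i j = Qₚ.*-zeroʳ (ι (suc n))

θz-y : θ zDegree yP ≈ P.0#
θz-y zero    k i j = Qₚ.*-zeroˡ (yP 0 k i j)
θz-y (suc n) k i j = Qₚ.*-zeroʳ (ι (suc n))

θy-y : θ yDegree yP ≈ yP
θy-y zero    zero    zero    zero          = refl
θy-y zero    zero    zero    (suc zero)    = refl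
θy-y zero    zero    zero    (suc (suc j)) = Qₚ.*-zeroʳ (ι (suc (suc j)))
θy-y zero    zero    (suc i) j             = Qₚ.*-zeroʳ (ι j)
θy-y zero    (suc k) i       j             = Qₚ.*-zeroʳ (ι j)
θy-y (suc n) k       i       j             = Qₚ.*-zeroʳ (ι j)

θy-z : θ yDegree zP ≈ P.0#
θy-z zero          k       i       j       = Qₚ.*-zeroʳ (ι j)
θy-z (suc zero)    zero    zero    zero    = refl
θy-z (suc zero)    zero    zero    (suc j) = Qₚ.*-zeroʳ (ι (suc j))
θy-z (suc zero)    zero    (suc i) j       = Qₚ.*-zeroʳ (ι j)
θy-z (suc zero)    (suc k) i       j       = Qₚ.*-zeroʳ (ι j)
θy-z (suc (suc n)) k       i       j       = Qₚ.*-zeroʳ (ι j)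

θy-u : θ yDegree uP ≈ P.0#
θy-u zero    zero          i       j       = Qₚ.*-zeroʳ (ι j)
θy-u zero    (suc zero)    zero    zero    = refl
θy-u zero    (suc zero)    zero    (suc j) = Qₚ.*-zeroʳ (ι (suc j))
θy-u zero    (suc zero)    (suc i) j       = Qₚ.*-zeroʳ (ι j)
θy-u zero    (suc (suc k)) i       j       = Qₚ.*-zeroʳ (ι j)
θy-u (suc n) k             i       j       = Qₚ.*-zeroʳ (ι j)

θy-x : θ yDegree xP ≈ P.0#
θy-x zero    zero    zero          j       = Qₚ.*-zeroʳ (ι j)
θy-x zero    zero    (suc zero)    zero    = refl
θy-x zero    zero    (suc zero)    (suc j) = Qₚ.*-zeroʳ (ι (suc j))
θy-x zero    zero    (suc (suc i)) j       = Qₚ.*-zeroʳ (ι j)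
θy-x zero    (suc k) i             j       = Qₚ.*-zeroʳ (ι j)
θy-x (suc n) k       i             j       = Qₚ.*-zeroʳ (ι j)

θz-F : θ zDegree F ≈ zP ⊗ (yP ⊗ v ⊗ F ⊕ (xP ⊕ yP) ⊗ (uP ⊗ (E ⊗ h ⊗ F)))
θz-F = begin
  θ zDegree F                        ≈⟨ θF ⟩
  θ zDegree W ⊗ F                    ≈⟨ P.*-congʳ {F} θW ⟩
  (zP ⊗ yP ⊗ v ⊕ (xP ⊕ yP) ⊗ (uP ⊗ I ⊗ E ⊗ (zP ⊗ v))) ⊗ F
    -- The factor `v` coming from `e` joins `I`, and `v :* I` is `h` unfolded.
    ≈⟨ solve 9 (λ z y v x u I E F h → (z :* y :* v :+ (x :+ y) :* (u :* I :* E :* (z :* v))) :* F :=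
                                    z :* (y :* v :* F :+ (x :+ y) :* (u :* (E :* (v :* I) :* F))))
         P.refl zP yP v xP uP I E F h ⟩
  zP ⊗ (yP ⊗ v ⊗ F ⊕ (xP ⊕ yP) ⊗ (uP ⊗ (E ⊗ h ⊗ F))) ∎
  where
  open import Relation.Binary.Reasoning.Setoid P.setoid
  open PS-Solver
  open SeriesCalculus {zDegree} (λ {n} {k} {i} {j} → zDegree-additive {n} {k} {i} {j})
  θe : θ zDegree e ≈ zP ⊗ v
  θe = P.trans (D-constant-*ʳ zP {v} (Dv≈0 θz-u)) (P.*-congʳ {v} θz-z)
  θW : θ zDegree W ≈ zP ⊗ yP ⊗ v ⊕ (xP ⊕ yP) ⊗ (uP ⊗ I ⊗ E ⊗ (zP ⊗ v))
  θW = begin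
    θ zDegree W
      ≈⟨ θ-⊕ zDegree (zP ⊗ yP ⊗ v) ((xP ⊕ yP) ⊗ λh) ⟩
    θ zDegree (zP ⊗ yP ⊗ v) ⊕ θ zDegree ((xP ⊕ yP) ⊗ λh)
      ≈⟨ P.+-cong
           (P.trans (D-constant-*ʳ (zP ⊗ yP) {v} (Dv≈0 θz-u))
             (P.*-congʳ {v} (P.trans (D-constant-*ʳ zP {yP} θz-y) (P.*-congʳ {yP} θz-z))))
           (P.trans (D-constant-*ˡ {xP ⊕ yP} λh (D-constant-+ {xP} {yP} θz-x θz-y))
             (P.*-congˡ {xP ⊕ yP} (P.trans (θλ θz-u) (P.*-congˡ {uP ⊗ I ⊗ E} θe)))) ⟩
    zP ⊗ yP ⊗ v ⊕ (xP ⊕ yP) ⊗ (uP ⊗ I ⊗ E ⊗ (zP ⊗ v)) ∎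

module θy where

  open import Relation.Binary.Reasoning.Setoid P.setoid
  open PS-Solver
  open SeriesCalculus {yDegree} (λ {n} {k} {i} {j} → yDegree-additive {n} {k} {i} {j}) public

  θy-e : θ yDegree e ≈ P.0#
  θy-e = D-constant-* {zP} {v} θy-z (Dv≈0 θy-u)

  θy-λh : θ yDegree λh ≈ P.0#
  θy-λh = P.trans (θλ θy-u) (P.trans (P.*-congˡ {uP ⊗ I ⊗ E} θy-e) (P.zeroʳ (uP ⊗ I ⊗ E)))

  θy-α : θ yDegree α ≈ P.0#
  θy-α = D-constant-+ {e} {λh} θy-e θy-λh

  -- W = y α + x ln h is linear in y, with α and ln h free of y.
  θy-W : θ yDegree W ≈ yP ⊗ α
  θy-W = begin
    θ yDegree W
      ≈⟨ θ-⊕ yDegree (zP ⊗ yP ⊗ v) ((xP ⊕ yP) ⊗ λh) ⟩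
    θ yDegree (zP ⊗ yP ⊗ v) ⊕ θ yDegree ((xP ⊕ yP) ⊗ λh)
      ≈⟨ P.+-cong
           (P.trans (D-constant-*ʳ (zP ⊗ yP) {v} (Dv≈0 θy-u))
             (P.*-congʳ {v} (P.trans (D-constant-*ˡ {zP} yP θy-z) (P.*-congˡ {zP} θy-y))))
           (P.trans (D-constant-*ʳ (xP ⊕ yP) {λh} θy-λh)
             (P.*-congʳ {λh} (P.trans (θ-⊕ yDegree xP yP) (P.trans (P.+-cong θy-x θy-y) (P.+-identityˡ yP))))) ⟩
    zP ⊗ yP ⊗ v ⊕ yP ⊗ λh
      ≈⟨ solve 4 (λ z y v l → z :* y :* v :+ y :* l := y :* (z :* v :+ l)) P.refl zP yP v λh ⟩
    yP ⊗ α ∎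

  θy-α^ : ∀ t → θ yDegree (α ^P t) ≈ P.0#
  θy-α^ zero    = θ-one
  θy-α^ (suc t) = D-constant-* {α} {α ^P t} θy-α (θy-α^ t)

  -- Each differentiation in y contributes one more factor α, as only `F` depends on y.
  θy-F⊗α^ : ∀ t → θ yDegree (F ⊗ α ^P t) ≈ yP ⊗ (F ⊗ α ^P suc t)
  θy-F⊗α^ t = begin
    θ yDegree (F ⊗ α ^P t)     ≈⟨ D-constant-*ʳ F {α ^P t} (θy-α^ t) ⟩
    θ yDegree F ⊗ α ^P t       ≈⟨ P.*-congʳ {α ^P t} (P.trans θF (P.*-congʳ {F} θy-W)) ⟩
    yP ⊗ α ⊗ F ⊗ α ^P t
      ≈⟨ solve 4 (λ y a f b → y :* a :* f :* b := y :* (f :* (a :* b))) P.refl yP α F (α ^P t) ⟩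
    yP ⊗ (F ⊗ α ^P suc t)      ∎

open θy using (θy-F⊗α^)

-- Away from the origin the total degree is positive and can be cancelled.
constant-of-θdegree≈0 : ∀ f → θ degree f ≈ P.0# → f 0 0 0 0 ≡ 1ℚ → f ≈ oneP
constant-of-θdegree≈0 f p f₀ zero zero zero zero    = f₀
constant-of-θdegree≈0 f p f₀ zero zero zero (suc j) = ι-cancel j (trans (p 0 0 0 (suc j)) (sym (Qₚ.*-zeroʳ (ι (suc j)))))
constant-of-θdegree≈0 f p f₀ zero zero (suc i) j    = ι-cancel (i ℕ.+ j) (trans (p 0 0 (suc i) j) (sym (Qₚ.*-zeroʳ (ι (suc (i ℕ.+ j))))))
constant-of-θdegree≈0 f p f₀ zero (suc k) i j       = ι-cancel (k ℕ.+ i ℕ.+ j) (trans (p 0 (suc k) i j) (sym (Qₚ.*-zeroʳ (ι (suc (k ℕ.+ i ℕ.+ j))))))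
constant-of-θdegree≈0 f p f₀ (suc n) k i j          = ι-cancel (n ℕ.+ k ℕ.+ i ℕ.+ j) (trans (p (suc n) k i j) (sym (Qₚ.*-zeroʳ (ι (suc (n ℕ.+ k ℕ.+ i ℕ.+ j))))))

-- Both sides solve θ X = θ α · X for the total degree operator, so each is inverse to exp (- α).
expα≈Eh : expP α ≈ E ⊗ h
expα≈Eh = begin
  expP α                     ≈⟨ P.*-identityʳ (expP α) ⟨
  expP α ⊗ oneP              ≈⟨ P.*-congˡ {expP α} (inverse (E ⊗ h) θEh refl) ⟨
  expP α ⊗ (E ⊗ h ⊗ H)       ≈⟨ solve 3 (λ a b c → a :* (b :* c) := b :* (a :* c)) P.refl (expP α) (E ⊗ h) H ⟩
  E ⊗ h ⊗ (expP α ⊗ H)       ≈⟨ P.*-congˡ {E ⊗ h} (inverse (expP α) (θ-exp α (atZ0⇒below-1 {α} vanishesAtZ0-α)) refl) ⟩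
  E ⊗ h ⊗ oneP               ≈⟨ P.*-identityʳ (E ⊗ h) ⟩
  E ⊗ h                      ∎
  where
  open import Relation.Binary.Reasoning.Setoid P.setoid
  open PS-Solver
  open SeriesCalculus {degree} (λ {n} {k} {i} {j} → degree-additive {n} {k} {i} {j})
  H = expP (P.- α)
  α⁻₀ : VanishesBelow 1 (P.- α)
  α⁻₀ = atZ0⇒below-1 {P.- α} λ k i j → cong -_ (vanishesAtZ0-α k i j)
  inverse : ∀ X → θ degree X ≈ θ degree α ⊗ X → X 0 0 0 0 ≡ 1ℚ → X ⊗ H ≈ oneP
  inverse X θX X₀ = constant-of-θdegree≈0 (X ⊗ H) θXH (cong (_* H 0 0 0 0) X₀)
    where
    θXH : θ degree (X ⊗ H) ≈ P.0#
    θXH = begin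
      θ degree (X ⊗ H)                         ≈⟨ θ-⊗ X H ⟩
      θ degree X ⊗ H ⊕ X ⊗ θ degree H
        ≈⟨ P.+-cong (P.*-congʳ {H} θX) (P.*-congˡ {X} (P.trans (θ-exp (P.- α) α⁻₀) (P.*-congʳ {H} (θ-neg degree α)))) ⟩
      θ degree α ⊗ X ⊗ H ⊕ X ⊗ ((P.- θ degree α) ⊗ H)
        ≈⟨ solve 4 (λ a X H b → a :* X :* H :+ X :* (b :* H) := (a :+ b) :* (X :* H)) P.refl
             (θ degree α) X H (P.- θ degree α) ⟩
      (θ degree α ⊕ P.- θ degree α) ⊗ (X ⊗ H)  ≈⟨ P.*-congʳ {X ⊗ H} (P.-‿inverseʳ (θ degree α)) ⟩
      P.0# ⊗ (X ⊗ H)                           ≈⟨ P.zeroˡ (X ⊗ H) ⟩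
      P.0#                                     ∎
  θEh : θ degree (E ⊗ h) ≈ θ degree α ⊗ (E ⊗ h)
  θEh = begin
    θ degree (E ⊗ h)                              ≈⟨ θ-⊗ E h ⟩
    θ degree E ⊗ h ⊕ E ⊗ θ degree h
      ≈⟨ P.+-cong (P.*-congʳ {h} θE) (P.*-congˡ {E} (P.sym θλ⊗h)) ⟩
    θ degree e ⊗ E ⊗ h ⊕ E ⊗ (θ degree λh ⊗ h)
      ≈⟨ solve 4 (λ a b E h → a :* E :* h :+ E :* (b :* h) := (a :+ b) :* (E :* h)) P.refl
           (θ degree e) (θ degree λh) E h ⟩
    (θ degree e ⊕ θ degree λh) ⊗ (E ⊗ h)          ≈⟨ P.*-congʳ {E ⊗ h} (θ-⊕ degree e λh) ⟨
    θ degree α ⊗ (E ⊗ h)                          ∎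

-- Taylor's formula in y: binomials and multiplication by a variable.

[1+k]*[1+n]C[1+k]≡[1+n]*nCk : ∀ n k → suc k ℕ.* (suc n C suc k) ≡ suc n ℕ.* (n C k)
[1+k]*[1+n]C[1+k]≡[1+n]*nCk n       zero    = trans (ℕₚ.*-identityˡ _) (trans (nC1≡n (suc n)) (sym (ℕₚ.*-identityʳ (suc n))))
[1+k]*[1+n]C[1+k]≡[1+n]*nCk zero    (suc k) = ℕₚ.*-zeroʳ (suc (suc k))
[1+k]*[1+n]C[1+k]≡[1+n]*nCk (suc n) (suc k) = begin
  suc (suc k) ℕ.* (suc (suc n) C suc (suc k))
    ≡⟨ cong (suc (suc k) ℕ.*_) (nCk+nC[k+1]≡[n+1]C[k+1] (suc n) (suc k)) ⟨
  suc (suc k) ℕ.* (suc n C suc k ℕ.+ suc n C suc (suc k))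
    ≡⟨ solve 3 (λ k a b → (con 1 :+ k) :* (a :+ b) := a :+ (k :* a :+ (con 1 :+ k) :* b)) refl
         (suc k) (suc n C suc k) (suc n C suc (suc k)) ⟩
  suc n C suc k ℕ.+ (suc k ℕ.* (suc n C suc k) ℕ.+ suc (suc k) ℕ.* (suc n C suc (suc k)))
    ≡⟨ cong (suc n C suc k ℕ.+_) (cong₂ ℕ._+_ ([1+k]*[1+n]C[1+k]≡[1+n]*nCk n k) ([1+k]*[1+n]C[1+k]≡[1+n]*nCk n (suc k))) ⟩
  suc n C suc k ℕ.+ (suc n ℕ.* (n C k) ℕ.+ suc n ℕ.* (n C suc k))
    ≡⟨ cong (suc n C suc k ℕ.+_) (ℕₚ.*-distribˡ-+ (suc n) (n C k) (n C suc k)) ⟨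
  suc n C suc k ℕ.+ suc n ℕ.* (n C k ℕ.+ n C suc k)
    ≡⟨ cong (λ t → suc n C suc k ℕ.+ suc n ℕ.* t) (nCk+nC[k+1]≡[n+1]C[k+1] n k) ⟩
  suc (suc n) ℕ.* (suc n C suc k) ∎
  where open ≡-Reasoning
        open +-*-Solver

[t+j]Cj≡[t+j]Ct : ∀ t j → (t ℕ.+ j) C j ≡ (t ℕ.+ j) C t
[t+j]Cj≡[t+j]Ct t j = trans (nCk≡nC[n∸k] (ℕₚ.m≤n+m j t)) (cong ((t ℕ.+ j) C_) (ℕₚ.m+n∸n≡m t j))

-- Both sides are (t + j + 1) times the binomial of t + j over j, by absorption. It trades a Taylor
-- order `t` for an exponent `j`.
[1+t]*[1+t+j]Cj : ∀ t j → suc t ℕ.* ((suc t ℕ.+ j) C j) ≡ suc j ℕ.* ((t ℕ.+ suc j) C suc j)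
[1+t]*[1+t+j]Cj t j = begin
  suc t ℕ.* ((suc t ℕ.+ j) C j)        ≡⟨ cong (suc t ℕ.*_) ([t+j]Cj≡[t+j]Ct (suc t) j) ⟩
  suc t ℕ.* (suc (t ℕ.+ j) C suc t)    ≡⟨ [1+k]*[1+n]C[1+k]≡[1+n]*nCk (t ℕ.+ j) t ⟩
  suc (t ℕ.+ j) ℕ.* ((t ℕ.+ j) C t)    ≡⟨ cong (suc (t ℕ.+ j) ℕ.*_) ([t+j]Cj≡[t+j]Ct t j) ⟨
  suc (t ℕ.+ j) ℕ.* ((t ℕ.+ j) C j)    ≡⟨ [1+k]*[1+n]C[1+k]≡[1+n]*nCk (t ℕ.+ j) j ⟨
  suc j ℕ.* (suc (t ℕ.+ j) C suc j)    ≡⟨ cong (λ m → suc j ℕ.* (m C suc j)) (ℕₚ.+-suc t j) ⟨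
  suc j ℕ.* ((t ℕ.+ suc j) C suc j)    ∎
  where open ≡-Reasoning

-- Multiplication by a variable, seen on the coefficients in that variable.
lower : (ℕ → ℚ) → ℕ → ℚ
lower g zero    = 0ℚ
lower g (suc m) = g m

lower-cong : ∀ {g g′} → (∀ m → g m ≡ g′ m) → ∀ m → lower g m ≡ lower g′ m
lower-cong e zero    = refl
lower-cong e (suc m) = e m

sum-second : ∀ m (f g : ℕ → ℚ) → f 0 ≡ 0ℚ → f 1 ≡ 1ℚ → (∀ a → f (suc (suc a)) ≡ 0ℚ) →
             sumTo m (λ a → f a * g (m ∸ a)) ≡ lower g m
sum-second zero    f g f₀ f₁ f₂ = trans (cong (_* g 0) f₀) (Qₚ.*-zeroˡ (g 0))
sum-second (suc m) f g f₀ f₁ f₂ = begin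
  sumTo (suc m) (λ a → f a * g (suc m ∸ a))
    ≡⟨ sum-head m _ ⟩
  f 0 * g (suc m) + sumTo m (λ a → f (suc a) * g (m ∸ a))
    ≡⟨ cong₂ _+_ (trans (cong (_* g (suc m)) f₀) (Qₚ.*-zeroˡ (g (suc m))))
         (sum-single m λ a → trans (cong (_* g (m ∸ suc a)) (f₂ a)) (Qₚ.*-zeroˡ (g (m ∸ suc a)))) ⟩
  0ℚ + f 1 * g m
    ≡⟨ trans (Qₚ.+-identityˡ _) (trans (cong (_* g m) f₁) (Qₚ.*-identityˡ (g m))) ⟩
  g m ∎
  where open ≡-Reasoning

sum³-0 : ∀ k i j (F G : ℕ → ℕ → ℕ → ℚ) → (∀ b c d → F b c d ≡ 0ℚ) →
         (sumTo k λ b → sumTo i λ c → sumTo j λ d → F b c d * G b c d) ≡ 0ℚ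
sum³-0 k i j F G e = sum-0 k λ b _ → sum-0 i λ c _ → sum-0 j λ d _ →
  trans (cong (_* G b c d) (e b c d)) (Qₚ.*-zeroˡ (G b c d))

sum²-0 : ∀ i j (F G : ℕ → ℕ → ℚ) → (∀ c d → F c d ≡ 0ℚ) →
         (sumTo i λ c → sumTo j λ d → F c d * G c d) ≡ 0ℚ
sum²-0 i j F G e = sum-0 i λ c _ → sum-0 j λ d _ →
  trans (cong (_* G c d) (e c d)) (Qₚ.*-zeroˡ (G c d))

sum¹-0 : ∀ j (F G : ℕ → ℚ) → (∀ d → F d ≡ 0ℚ) → sumTo j (λ d → F d * G d) ≡ 0ℚ
sum¹-0 j F G e = sum-0 j λ d _ → trans (cong (_* G d) (e d)) (Qₚ.*-zeroˡ (G d))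

y⊗ : ∀ f n k i j → (yP ⊗ f) n k i j ≡ lower (f n k i) j
y⊗ f n k i j =
  trans (sum-single n λ a → sum³-0 k i j _ (λ b c d → f (n ∸ suc a) (k ∸ b) (i ∸ c) (j ∸ d)) λ _ _ _ → refl)
  (trans (sum-single k λ b → sum²-0 i j _ (λ c d → f n (k ∸ suc b) (i ∸ c) (j ∸ d)) λ _ _ → refl)
  (trans (sum-single i λ c → sum¹-0 j _ (λ d → f n k (i ∸ suc c) (j ∸ d)) λ _ → refl)
  (sum-second j (yP 0 0 0) (f n k i) refl refl λ _ → refl)))

x⊗ : ∀ f n k i j → (xP ⊗ f) n k i j ≡ lower (λ i → f n k i j) i
x⊗ f n k i j =
  trans (sum-single n λ a → sum³-0 k i j _ (λ b c d → f (n ∸ suc a) (k ∸ b) (i ∸ c) (j ∸ d)) λ _ _ _ → refl)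
  (trans (sum-single k λ b → sum²-0 i j _ (λ c d → f n (k ∸ suc b) (i ∸ c) (j ∸ d)) λ _ _ → refl)
  (trans (sum-cong i λ c _ → sum-single j λ d → trans (cong (_* f n k (i ∸ c) (j ∸ suc d)) (x≡0 c d)) (Qₚ.*-zeroˡ (f n k (i ∸ c) (j ∸ suc d))))
  (sum-second i (λ c → xP 0 0 c 0) (λ i → f n k i j) refl refl λ _ → refl)))
  where
  x≡0 : ∀ c d → xP 0 0 c (suc d) ≡ 0ℚ
  x≡0 zero          d = refl
  x≡0 (suc zero)    d = refl
  x≡0 (suc (suc c)) d = refl

u⊗ : ∀ f n k i j → (uP ⊗ f) n k i j ≡ lower (λ k → f n k i j) k
u⊗ f n k i j =
  trans (sum-single n λ a → sum³-0 k i j _ (λ b c d → f (n ∸ suc a) (k ∸ b) (i ∸ c) (j ∸ d)) λ _ _ _ → refl)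
  (trans (sum-cong k λ b _ → trans (sum-single i λ c → sum¹-0 j _ (λ d → f n (k ∸ b) (i ∸ suc c) (j ∸ d)) (u≡0 b c))
                                  (sum-single j λ d → trans (cong (_* f n (k ∸ b) i (j ∸ suc d)) (u≡0′ b d)) (Qₚ.*-zeroˡ (f n (k ∸ b) i (j ∸ suc d)))))
  (sum-second k (λ b → uP 0 b 0 0) (λ k → f n k i j) refl refl λ _ → refl))
  where
  u≡0 : ∀ b c d → uP 0 b (suc c) d ≡ 0ℚ
  u≡0 zero          c d = refl
  u≡0 (suc zero)    c d = refl
  u≡0 (suc (suc b)) c d = refl
  u≡0′ : ∀ b d → uP 0 b 0 (suc d) ≡ 0ℚ
  u≡0′ zero          d = refl
  u≡0′ (suc zero)    d = refl
  u≡0′ (suc (suc b)) d = refl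

z⊗ : ∀ f n k i j → (zP ⊗ f) n k i j ≡ lower (λ n → f n k i j) n
z⊗ f n k i j =
  trans (sum-cong n λ a _ →
    trans (sum-single k λ b → sum²-0 i j _ (λ c d → f (n ∸ a) (k ∸ suc b) (i ∸ c) (j ∸ d)) (z≡0 a b))
    (trans (sum-single i λ c → sum¹-0 j _ (λ d → f (n ∸ a) k (i ∸ suc c) (j ∸ d)) (z≡0′ a c))
    (sum-single j λ d → trans (cong (_* f (n ∸ a) k i (j ∸ suc d)) (z≡0″ a d)) (Qₚ.*-zeroˡ (f (n ∸ a) k i (j ∸ suc d))))))
  (sum-second n (λ a → zP a 0 0 0) (λ n → f n k i j) refl refl λ _ → refl)
  where
  z≡0 : ∀ a b c d → zP a (suc b) c d ≡ 0ℚ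
  z≡0 zero          b c d = refl
  z≡0 (suc zero)    b c d = refl
  z≡0 (suc (suc a)) b c d = refl
  z≡0′ : ∀ a c d → zP a 0 (suc c) d ≡ 0ℚ
  z≡0′ zero          c d = refl
  z≡0′ (suc zero)    c d = refl
  z≡0′ (suc (suc a)) c d = refl
  z≡0″ : ∀ a d → zP a 0 0 (suc d) ≡ 0ℚ
  z≡0″ zero          d = refl
  z≡0″ (suc zero)    d = refl
  z≡0″ (suc (suc a)) d = refl

-- The substitution y ↦ y + 1, for series of y-degree at most the z-degree.
shiftY : PS → PS
shiftY f n k i j = sumTo (degree n k i j) λ t → ι ((t ℕ.+ j) C j) * f n k i (t ℕ.+ j)

-- The left side is the coefficient of y^j in the t-th y-derivative of F divided by t!, and that
-- derivative is α^t F. The induction passes from (t, j + 1) to (t + 1, j).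
F-taylor : ∀ n k i t j → ι ((t ℕ.+ j) C j) * F n k i (t ℕ.+ j) ≡ invFact t * (F ⊗ α ^P t) n k i j
F-taylor n k i zero    j = cong₂ _*_ (cong ι (nCn≡1 j)) (sym (P.*-identityʳ F n k i j))
F-taylor n k i (suc t) j = ι-cancel t (begin
  ι (suc t) * (ι ((suc t ℕ.+ j) C j) * F n k i (suc t ℕ.+ j))
    ≡⟨ Qₚ.*-assoc (ι (suc t)) _ _ ⟨
  ι (suc t) * ι ((suc t ℕ.+ j) C j) * F n k i (suc t ℕ.+ j)
    ≡⟨ cong₂ _*_ (trans (sym (ι-* (suc t) ((suc t ℕ.+ j) C j))) (trans (cong ι ([1+t]*[1+t+j]Cj t j)) (ι-* (suc j) ((t ℕ.+ suc j) C suc j))))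
                 (cong (F n k i) (sym (ℕₚ.+-suc t j))) ⟩
  ι (suc j) * ι ((t ℕ.+ suc j) C suc j) * F n k i (t ℕ.+ suc j)
    ≡⟨ Qₚ.*-assoc (ι (suc j)) _ _ ⟩
  ι (suc j) * (ι ((t ℕ.+ suc j) C suc j) * F n k i (t ℕ.+ suc j))
    ≡⟨ cong (ι (suc j) *_) (F-taylor n k i t (suc j)) ⟩
  ι (suc j) * (invFact t * (F ⊗ α ^P t) n k i (suc j))
    ≡⟨ swap (ι (suc j)) (invFact t) _ ⟩
  -- The factor `ι (suc j)` at exponent `suc j` is the Euler operator; the y that it yields lowers
  -- the exponent back to `j`.
  invFact t * θ yDegree (F ⊗ α ^P t) n k i (suc j)
    ≡⟨ cong (invFact t *_) (trans (θy-F⊗α^ t n k i (suc j)) (y⊗ (F ⊗ α ^P suc t) n k i (suc j))) ⟩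
  invFact t * (F ⊗ α ^P suc t) n k i j
    ≡⟨ cong (_* (F ⊗ α ^P suc t) n k i j) (sym (invFact-suc t)) ⟩
  ι (suc t) * invFact (suc t) * (F ⊗ α ^P suc t) n k i j
    ≡⟨ Qₚ.*-assoc (ι (suc t)) _ _ ⟩
  ι (suc t) * (invFact (suc t) * (F ⊗ α ^P suc t) n k i j) ∎)
  where
  open ≡-Reasoning
  open ℚS
  swap : ∀ x y z → x * (y * z) ≡ y * (x * z)
  swap = solve 3 (λ x y z → x :* (y :* z) := y :* (x :* z)) refl

-- Summing the Taylor terms gives F exp α. The cutoff is exact because α^t has order at least t.
shiftY-F : shiftY F ≈ E ⊗ h ⊗ F
shiftY-F n k i j = begin
  shiftY F n k i j
    ≡⟨ sum-cong (degree n k i j) (λ t _ → F-taylor n k i t j) ⟩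
  sumTo (degree n k i j) (λ t → invFact t * (F ⊗ α ^P t) n k i j)
    ≡⟨ ⊗-comp {α} (atZ0⇒below-1 {α} vanishesAtZ0-α) F invFact n k i j ⟨
  (F ⊗ expP α) n k i j
    ≡⟨ P.trans (P.*-congˡ {F} expα≈Eh) (P.*-comm F (E ⊗ h)) n k i j ⟩
  (E ⊗ h ⊗ F) n k i j ∎
  where open ≡-Reasoning

-- The operator y (1 - u) f + u (x + y) f (y + 1) on coefficients; its recurrence and uniqueness.

step : PS → PS
step f n k i j = lower (f n k i) j - lower (λ k → lower (f n k i) j) k
               + (lower (λ i → lower (λ k → shiftY f n k i j) k) i
                + lower (λ j → lower (λ k → shiftY f n k i j) k) j)

F-step : ∀ n k i j → ι (suc n) * F (suc n) k i j ≡ step F n k i j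
F-step n k i j = begin
  θ zDegree F (suc n) k i j
    ≡⟨ θz-F (suc n) k i j ⟩
  (zP ⊗ (yP ⊗ v ⊗ F ⊕ (xP ⊕ yP) ⊗ (uP ⊗ (E ⊗ h ⊗ F)))) (suc n) k i j
    ≡⟨ z⊗ (yP ⊗ v ⊗ F ⊕ (xP ⊕ yP) ⊗ (uP ⊗ (E ⊗ h ⊗ F))) (suc n) k i j ⟩
  (yP ⊗ v ⊗ F) n k i j + ((xP ⊕ yP) ⊗ (uP ⊗ (E ⊗ h ⊗ F))) n k i j
    ≡⟨ cong₂ _+_ west (trans (P.*-congˡ {xP ⊕ yP} (P.*-congˡ {uP} (P.sym shiftY-F)) n k i j)
                      (P.distribʳ (uP ⊗ S) xP yP n k i j)) ⟩
  lower (F n k i) j - lower (λ k → lower (F n k i) j) k + ((xP ⊗ (uP ⊗ S)) n k i j + (yP ⊗ (uP ⊗ S)) n k i j)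
    ≡⟨ cong (lower (F n k i) j - lower (λ k → lower (F n k i) j) k +_) (cong₂ _+_
         (trans (x⊗ (uP ⊗ S) n k i j) (lower-cong (λ i → u⊗ S n k i j) i))
         (trans (y⊗ (uP ⊗ S) n k i j) (lower-cong (λ j → u⊗ S n k i j) j))) ⟩
  step F n k i j ∎
  where
  open ≡-Reasoning
  open PS-Solver
  S = shiftY F
  v⊗yF : v ⊗ (yP ⊗ F) ≈ (yP ⊗ F) ⊖ uP ⊗ (yP ⊗ F)
  v⊗yF = ⊕-cancelʳ (uP ⊗ (yP ⊗ F)) (v ⊗ (yP ⊗ F)) ((yP ⊗ F) ⊖ uP ⊗ (yP ⊗ F))
    (P.trans (P.sym (P.distribʳ (yP ⊗ F) v uP))
    (P.trans (P.*-congʳ {yP ⊗ F} v⊕u≈1)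
    (P.trans (P.*-identityˡ (yP ⊗ F)) (P.sym (⊖-⊕ (yP ⊗ F) (uP ⊗ (yP ⊗ F)))))))
  west : (yP ⊗ v ⊗ F) n k i j ≡ lower (F n k i) j - lower (λ k → lower (F n k i) j) k
  west = trans (solve 3 (λ y v f → y :* v :* f := v :* (y :* f)) P.refl yP v F n k i j)
        (trans (v⊗yF n k i j)
        (cong₂ _-_ (y⊗ F n k i j) (trans (u⊗ (yP ⊗ F) n k i j) (lower-cong (λ k → y⊗ F n k i j) k))))

step-local : ∀ f g n → (∀ k i j → f n k i j ≡ g n k i j) → ∀ k i j → step f n k i j ≡ step g n k i j
step-local f g n e k i j = cong₂ _+_
  (cong₂ _-_ (lower-cong (e k i) j) (lower-cong (λ k → lower-cong (e k i) j) k))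
  (cong₂ _+_ (lower-cong (λ i → lower-cong (λ k → shift k i j) k) i)
             (lower-cong (λ j → lower-cong (λ k → shift k i j) k) j))
  where
  shift : ∀ k i j → shiftY f n k i j ≡ shiftY g n k i j
  shift k i j = sum-cong (degree n k i j) λ t _ → cong (ι ((t ℕ.+ j) C j) *_) (e k i (t ℕ.+ j))

step-unique : ∀ f g → (∀ k i j → f 0 k i j ≡ g 0 k i j) →
              (∀ n k i j → ι (suc n) * f (suc n) k i j ≡ step f n k i j) →
              (∀ n k i j → ι (suc n) * g (suc n) k i j ≡ step g n k i j) →
              f ≈ g
step-unique f g f₀≡g₀ f-step g-step zero    k i j = f₀≡g₀ k i j
step-unique f g f₀≡g₀ f-step g-step (suc n) k i j = ι-cancel n
  (trans (f-step n k i j)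
  (trans (step-local f g n (step-unique f g f₀≡g₀ f-step g-step n) k i j) (sym (g-step n k i j))))

-- The tableau counts satisfy the recurrence.

δ : ℕ → ℕ → ℕ → StatWeight
δ k i j k′ i′ j′ = 𝟙 ((k′ ≡ᵇ k) ∧ (i′ ≡ᵇ i) ∧ (j′ ≡ᵇ j))

A≡tableauSum : ∀ n k i j → A i j n k ≡ tableauSum n (δ k i j)
A≡tableauSum n k i j = trans (length-filter _ (cartesianProduct (allShapes n) (allFillings n)))
  (trans (∑-cartesianProduct (allShapes n) (allFillings n) _)
  (∑-cong (allShapes n) λ s → ∑-cong (allFillings n) λ F →
    trans (cong 𝟙 (trans (does-≟-true _) (cong₂ _∧_ (isAltTableau≡valid s F)
      (cong₂ _∧_ (cong (_≡ᵇ k) (count≡countᶠ (isRow s)))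
      (cong₂ _∧_ (cong (_≡ᵇ i) (numFreeRows≡freeRows s F)) (cong (_≡ᵇ j) (numFreeCols≡freeCols s F)))))))
    (𝟙-∧ (valid s (entry F)) _)))

noLeftSum-cong : ∀ {w w′} → (∀ t → w t ≡ w′ t) → ∀ m → noLeftSum w m ≡ noLeftSum w′ m
noLeftSum-cong e zero    = e 0
noLeftSum-cong e (suc m) = cong₂ ℕ._+_ (noLeftSum-cong (e ∘ suc) m) (noLeftSum-cong e m)

noLeftSum-*ˡ : ∀ x w m → noLeftSum (λ t → x ℕ.* w t) m ≡ x ℕ.* noLeftSum w m
noLeftSum-*ˡ x w zero    = refl
noLeftSum-*ˡ x w (suc m) = trans (cong₂ ℕ._+_ (noLeftSum-*ˡ x (w ∘ suc) m) (noLeftSum-*ˡ x w m))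
                                 (sym (ℕₚ.*-distribˡ-+ x _ _))

noLeftSum-0 : ∀ {w} m → (∀ t → w t ≡ 0) → noLeftSum w m ≡ 0
noLeftSum-0 zero    e = e 0
noLeftSum-0 (suc m) e = cong₂ ℕ._+_ (noLeftSum-0 m (e ∘ suc)) (noLeftSum-0 m e)

-- The coefficient of y^j in (1 + y)^m: the recursion of `noLeftSum` is Pascal's rule.
noLeftSum-δ : ∀ j m → noLeftSum (λ t → 𝟙 (t ≡ᵇ j)) m ≡ m C j
noLeftSum-δ zero    zero    = refl
noLeftSum-δ (suc j) zero    = refl
noLeftSum-δ zero    (suc m) = cong₂ ℕ._+_ (noLeftSum-0 m λ _ → refl) (noLeftSum-δ zero m)
noLeftSum-δ (suc j) (suc m) = trans (cong₂ ℕ._+_ (noLeftSum-δ j m) (noLeftSum-δ (suc j) m)) (nCk+nC[k+1]≡[n+1]C[k+1] m j)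

∑≤ : ℕ → (ℕ → ℕ) → ℕ
∑≤ zero    f = f 0
∑≤ (suc N) f = f 0 ℕ.+ ∑≤ N (f ∘ suc)

∑≤-cong : ∀ N {f g : ℕ → ℕ} → (∀ t → f t ≡ g t) → ∑≤ N f ≡ ∑≤ N g
∑≤-cong zero    e = e 0
∑≤-cong (suc N) e = cong₂ ℕ._+_ (e 0) (∑≤-cong N (e ∘ suc))

∑≤-0 : ∀ N {f : ℕ → ℕ} → (∀ t → f t ≡ 0) → ∑≤ N f ≡ 0
∑≤-0 zero    e = e 0
∑≤-0 (suc N) e = cong₂ ℕ._+_ (e 0) (∑≤-0 N (e ∘ suc))

∑≤-*ˡ : ∀ N x (f : ℕ → ℕ) → ∑≤ N (λ t → x ℕ.* f t) ≡ x ℕ.* ∑≤ N f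
∑≤-*ˡ zero    x f = refl
∑≤-*ˡ (suc N) x f = trans (cong (x ℕ.* f 0 ℕ.+_) (∑≤-*ˡ N x (f ∘ suc))) (sym (ℕₚ.*-distribˡ-+ x _ _))

ι-∑≤ : ∀ N (f : ℕ → ℕ) → ι (∑≤ N f) ≡ sumTo N (ι ∘ f)
ι-∑≤ zero    f = refl
ι-∑≤ (suc N) f = trans (ι-+ (f 0) _) (trans (cong (ι (f 0) +_) (ι-∑≤ N (f ∘ suc))) (sym (sum-head N (ι ∘ f))))

tableauSum-∑≤ : ∀ n N (w : ℕ → StatWeight) →
                tableauSum n (λ k i j → ∑≤ N (λ t → w t k i j)) ≡ ∑≤ N (λ t → tableauSum n (w t))
tableauSum-∑≤ n zero    w = refl
tableauSum-∑≤ n (suc N) w = trans (tableauSum-+ n (w 0) (λ k i j → ∑≤ N (λ t → w (suc t) k i j)))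
                                  (cong (tableauSum n (w 0) ℕ.+_) (tableauSum-∑≤ n N (w ∘ suc)))

≡ᵇ-+ʳ : ∀ a t j → (a ℕ.+ j ≡ᵇ t ℕ.+ j) ≡ (a ≡ᵇ t)
≡ᵇ-+ʳ a t zero    = cong₂ _≡ᵇ_ (ℕₚ.+-identityʳ a) (ℕₚ.+-identityʳ t)
≡ᵇ-+ʳ a t (suc j) = trans (cong₂ _≡ᵇ_ (ℕₚ.+-suc a j) (ℕₚ.+-suc t j)) (≡ᵇ-+ʳ a t j)

∑≤-𝟙 : ∀ {a N} → a ≤ N → ∑≤ N (λ t → 𝟙 (a ≡ᵇ t)) ≡ 1
∑≤-𝟙 {zero}  {zero}  _         = refl
∑≤-𝟙 {zero}  {suc N} _         = cong suc (∑≤-0 N λ _ → refl)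
∑≤-𝟙 {suc a} {suc N} (s≤s a≤N) = ∑≤-𝟙 a≤N

*𝟙≡ᵇ : ∀ (f : ℕ → ℕ) m t → f t ℕ.* 𝟙 (m ≡ᵇ t) ≡ f m ℕ.* 𝟙 (m ≡ᵇ t)
*𝟙≡ᵇ f zero    zero    = refl
*𝟙≡ᵇ f zero    (suc t) = trans (ℕₚ.*-zeroʳ (f (suc t))) (sym (ℕₚ.*-zeroʳ (f 0)))
*𝟙≡ᵇ f (suc m) zero    = trans (ℕₚ.*-zeroʳ (f 0)) (sym (ℕₚ.*-zeroʳ (f (suc m))))
*𝟙≡ᵇ f (suc m) (suc t) = *𝟙≡ᵇ (f ∘ suc) m t

-- Only t = m - j contributes, and for j > m both sides vanish. The sum has the shape of `shiftY`.
binomial-expand : ∀ N j m → m ≤ N → m C j ≡ ∑≤ N (λ t → ((t ℕ.+ j) C j) ℕ.* 𝟙 (m ≡ᵇ t ℕ.+ j))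
binomial-expand N j m m≤N = sym (trans
  (trans (∑≤-cong N λ t → *𝟙≡ᵇ (_C j) m (t ℕ.+ j)) (∑≤-*ˡ N (m C j) (λ t → 𝟙 (m ≡ᵇ t ℕ.+ j))))
  pick)
  where
  pick : (m C j) ℕ.* ∑≤ N (λ t → 𝟙 (m ≡ᵇ t ℕ.+ j)) ≡ m C j
  pick with j ℕ.≤? m
  ... | no j≰m = trans (cong (ℕ._* ∑≤ N (λ t → 𝟙 (m ≡ᵇ t ℕ.+ j))) (k>n⇒nCk≡0 (ℕₚ.≰⇒> j≰m))) (sym (k>n⇒nCk≡0 (ℕₚ.≰⇒> j≰m)))
  ... | yes j≤m = trans (cong ((m C j) ℕ.*_)
      (trans (∑≤-cong N λ t → cong 𝟙 (trans (cong (_≡ᵇ t ℕ.+ j) (sym (ℕₚ.m∸n+n≡m j≤m))) (≡ᵇ-+ʳ (m ∸ j) t j)))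
             (∑≤-𝟙 (ℕₚ.≤-trans (ℕₚ.m∸n≤m m j) m≤N))))
    (ℕₚ.*-identityʳ (m C j))

tableauCount : PS
tableauCount n k i j = ι (tableauSum n (δ k i j))

noLeftSum-δ³ : ∀ N k i j k′ i′ m → m ≤ N →
               noLeftSum (δ k i j k′ i′) m ≡ ∑≤ N (λ t → ((t ℕ.+ j) C j) ℕ.* δ k i (t ℕ.+ j) k′ i′ m)
noLeftSum-δ³ N k i j k′ i′ m m≤N = begin
  noLeftSum (δ k i j k′ i′) m
    ≡⟨ noLeftSum-cong (λ t → split (k′ ≡ᵇ k) (i′ ≡ᵇ i) (t ≡ᵇ j)) m ⟩
  noLeftSum (λ t → b ℕ.* 𝟙 (t ≡ᵇ j)) m
    ≡⟨ noLeftSum-*ˡ b _ m ⟩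
  b ℕ.* noLeftSum (λ t → 𝟙 (t ≡ᵇ j)) m
    ≡⟨ cong (b ℕ.*_) (trans (noLeftSum-δ j m) (binomial-expand N j m m≤N)) ⟩
  b ℕ.* ∑≤ N (λ t → ((t ℕ.+ j) C j) ℕ.* 𝟙 (m ≡ᵇ t ℕ.+ j))
    ≡⟨ ∑≤-*ˡ N b _ ⟨
  ∑≤ N (λ t → b ℕ.* (((t ℕ.+ j) C j) ℕ.* 𝟙 (m ≡ᵇ t ℕ.+ j)))
    ≡⟨ ∑≤-cong N (λ t → trans (swap b ((t ℕ.+ j) C j) _) (cong (((t ℕ.+ j) C j) ℕ.*_) (sym (split (k′ ≡ᵇ k) (i′ ≡ᵇ i) _)))) ⟩
  ∑≤ N (λ t → ((t ℕ.+ j) C j) ℕ.* δ k i (t ℕ.+ j) k′ i′ m) ∎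
  where
  open ≡-Reasoning
  open +-*-Solver
  b = 𝟙 ((k′ ≡ᵇ k) ∧ (i′ ≡ᵇ i))
  split : ∀ x y z → 𝟙 (x ∧ y ∧ z) ≡ 𝟙 (x ∧ y) ℕ.* 𝟙 z
  split false y z = refl
  split true  y z = 𝟙-∧ y z
  swap : ∀ x y z → x ℕ.* (y ℕ.* z) ≡ y ℕ.* (x ℕ.* z)
  swap = solve 3 (λ x y z → x :* (y :* z) := y :* (x :* z)) refl

-- There are at most n free columns, and n is at most the cutoff `N`, so the expansion of the
-- binomial is complete.
shiftY-tableauCount : ∀ n k i j → ι (tableauSum n (λ k′ i′ → noLeftSum (δ k i j k′ i′))) ≡ shiftY tableauCount n k i j
shiftY-tableauCount n k i j = begin
  ι (tableauSum n (λ k′ i′ → noLeftSum (δ k i j k′ i′)))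
    ≡⟨ cong ι (tableauSum-cong n λ k′ i′ m m≤n → noLeftSum-δ³ N k i j k′ i′ m (ℕₚ.≤-trans m≤n n≤N)) ⟩
  ι (tableauSum n (λ k′ i′ m → ∑≤ N (λ t → ((t ℕ.+ j) C j) ℕ.* δ k i (t ℕ.+ j) k′ i′ m)))
    ≡⟨ cong ι (trans (tableauSum-∑≤ n N λ t k′ i′ m → ((t ℕ.+ j) C j) ℕ.* δ k i (t ℕ.+ j) k′ i′ m)
                     (∑≤-cong N λ t → tableauSum-*ˡ n ((t ℕ.+ j) C j) (δ k i (t ℕ.+ j)))) ⟩
  ι (∑≤ N (λ t → ((t ℕ.+ j) C j) ℕ.* tableauSum n (δ k i (t ℕ.+ j))))
    ≡⟨ ι-∑≤ N _ ⟩
  sumTo N (λ t → ι (((t ℕ.+ j) C j) ℕ.* tableauSum n (δ k i (t ℕ.+ j))))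
    ≡⟨ sum-cong N (λ t _ → ι-* ((t ℕ.+ j) C j) (tableauSum n (δ k i (t ℕ.+ j)))) ⟩
  shiftY tableauCount n k i j ∎
  where
  open ≡-Reasoning
  N = degree n k i j
  n≤N : n ≤ N
  n≤N = ℕₚ.≤-trans (ℕₚ.m≤m+n n k) (ℕₚ.≤-trans (ℕₚ.m≤m+n (n ℕ.+ k) i) (ℕₚ.m≤m+n (n ℕ.+ k ℕ.+ i) j))

tableauSum-0 : ∀ n {w : StatWeight} → (∀ k i j → w k i j ≡ 0) → ι (tableauSum n w) ≡ 0ℚ
tableauSum-0 n e = cong ι (∑-0 (allShapes n) λ s → ∑-0 (allFillings n) λ F →
  trans (cong (𝟙 (valid s (entry F)) ℕ.*_) (e _ _ _)) (ℕₚ.*-zeroʳ (𝟙 (valid s (entry F)))))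

-- `balance` is the subtraction-free recurrence; over ℚ the term `d` returns to the right. Below, an
-- index 0 meets an indicator of a successor, which gives the zero case of `lower`.
tableauCount-step : ∀ n k i j → tableauCount (suc n) k i j ≡ step tableauCount n k i j
tableauCount-step n k i j = begin
  a                                ≡⟨ Qₚ.+-identityʳ a ⟨
  a + 0ℚ                           ≡⟨ cong (a +_) (Qₚ.+-inverseʳ d) ⟨
  a + (d - d)                      ≡⟨ Qₚ.+-assoc a d (- d) ⟨
  a + d - d                        ≡⟨ cong (_- d) balance ⟩
  b + (x + y) - d                  ≡⟨ solve 3 (λ b s d → b :+ s :+ d := b :+ d :+ s) refl b (x + y) (- d) ⟩
  b - d + (x + y)                  ≡⟨ cong₂ _+_ (cong₂ _-_ (b≡ j) (d≡ k j)) (cong₂ _+_ (x≡ k i) (y≡ k j)) ⟩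
  step tableauCount n k i j        ∎
  where
  open ≡-Reasoning
  open ℚS
  a = tableauCount (suc n) k i j
  b = ι (tableauSum n (λ k′ i′ j′ → δ k i j k′ i′ (suc j′)))
  d = ι (tableauSum n (λ k′ i′ j′ → δ k i j (suc k′) i′ (suc j′)))
  x = ι (tableauSum n (λ k′ i′ → noLeftSum (δ k i j (suc k′) (suc i′))))
  y = ι (tableauSum n (λ k′ i′ → noLeftSum (δ k i j (suc k′) i′ ∘ suc)))
  balance : a + d ≡ b + (x + y)
  balance = trans (sym (ι-+ (tableauSum (suc n) (δ k i j)) _)) (trans (cong ι (tableauSum-step n (δ k i j)))
    (trans (ι-+ (tableauSum n (λ k′ i′ j′ → δ k i j k′ i′ (suc j′))) _) (cong (b +_) (ι-+ (tableauSum n (λ k′ i′ → noLeftSum (δ k i j (suc k′) (suc i′)))) _))))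
  𝟙-zero : ∀ p q → 𝟙 (p ∧ q ∧ false) ≡ 0
  𝟙-zero p q = cong 𝟙 (trans (cong (p ∧_) (∧-zeroʳ q)) (∧-zeroʳ p))
  b≡ : ∀ j → ι (tableauSum n (λ k′ i′ j′ → δ k i j k′ i′ (suc j′))) ≡ lower (tableauCount n k i) j
  b≡ zero    = tableauSum-0 n λ k′ i′ _ → 𝟙-zero (k′ ≡ᵇ k) (i′ ≡ᵇ i)
  b≡ (suc j) = refl
  d≡ : ∀ k j → ι (tableauSum n (λ k′ i′ j′ → δ k i j (suc k′) i′ (suc j′))) ≡ lower (λ k → lower (tableauCount n k i) j) k
  d≡ zero    j       = tableauSum-0 n λ _ _ _ → refl
  d≡ (suc k) zero    = tableauSum-0 n λ k′ i′ _ → 𝟙-zero (k′ ≡ᵇ k) (i′ ≡ᵇ i)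
  d≡ (suc k) (suc j) = refl
  x≡ : ∀ k i → ι (tableauSum n (λ k′ i′ → noLeftSum (δ k i j (suc k′) (suc i′)))) ≡
               lower (λ i → lower (λ k → shiftY tableauCount n k i j) k) i
  x≡ zero    zero    = tableauSum-0 n λ _ _ m → noLeftSum-0 m λ _ → refl
  x≡ zero    (suc i) = tableauSum-0 n λ _ _ m → noLeftSum-0 m λ _ → refl
  x≡ (suc k) zero    = tableauSum-0 n λ k′ _ m → noLeftSum-0 m λ _ → cong 𝟙 (∧-zeroʳ (k′ ≡ᵇ k))
  x≡ (suc k) (suc i) = shiftY-tableauCount n k i j
  y≡ : ∀ k j → ι (tableauSum n (λ k′ i′ → noLeftSum (δ k i j (suc k′) i′ ∘ suc))) ≡
               lower (λ j → lower (λ k → shiftY tableauCount n k i j) k) j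
  y≡ zero    zero    = tableauSum-0 n λ _ _ m → noLeftSum-0 m λ _ → refl
  y≡ zero    (suc j) = tableauSum-0 n λ _ _ m → noLeftSum-0 m λ _ → refl
  y≡ (suc k) zero    = tableauSum-0 n λ k′ i′ m → noLeftSum-0 m λ _ → 𝟙-zero (k′ ≡ᵇ k) (i′ ≡ᵇ i)
  y≡ (suc k) (suc j) = shiftY-tableauCount n k i j

-- Passing from counts to the exponential generating function.

lower-* : ∀ x (g : ℕ → ℚ) m → lower (λ t → g t * x) m ≡ lower g m * x
lower-* x g zero    = sym (Qₚ.*-zeroˡ x)
lower-* x g (suc m) = refl

-- `step` is linear and stays within one z-degree, so a factor depending on `n` alone, here 1/n!,
-- passes through.
step-* : ∀ f g n x → (∀ k i j → g n k i j ≡ f n k i j * x) → ∀ k i j → step g n k i j ≡ step f n k i j * x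
step-* f g n x e k i j = begin
  step g n k i j
    ≡⟨ cong₂ _+_ (cong₂ _-_ west (trans (lower-cong (λ k → low (e k i) j) k) (lower-* x _ k)))
                 (cong₂ _+_ (south (λ i k → shiftY g n k i j) (λ i k → shiftY f n k i j) (λ i k → shift k i j) i k)
                            (south (λ j k → shiftY g n k i j) (λ j k → shiftY f n k i j) (λ j k → shift k i j) j k)) ⟩
  b * x - d * x + (r₁ * x + r₂ * x)
    ≡⟨ cong (λ t → b * x + t + (r₁ * x + r₂ * x)) (Qₚ.neg-distribˡ-* d x) ⟩
  b * x + (- d) * x + (r₁ * x + r₂ * x)
    ≡⟨ solve 5 (λ b d p q x → b :* x :+ d :* x :+ (p :* x :+ q :* x) := (b :+ d :+ (p :+ q)) :* x) refl b (- d) r₁ r₂ x ⟩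
  step f n k i j * x ∎
  where
  open ≡-Reasoning
  open ℚS
  b = lower (f n k i) j
  d = lower (λ k → lower (f n k i) j) k
  r₁ = lower (λ i → lower (λ k → shiftY f n k i j) k) i
  r₂ = lower (λ j → lower (λ k → shiftY f n k i j) k) j
  low : ∀ {g h : ℕ → ℚ} → (∀ m → g m ≡ h m * x) → ∀ m → lower g m ≡ lower h m * x
  low {h = h} e m = trans (lower-cong e m) (lower-* x h m)
  west : lower (g n k i) j ≡ b * x
  west = low (e k i) j
  south : ∀ (G H : ℕ → ℕ → ℚ) → (∀ s t → G s t ≡ H s t * x) → ∀ s t →
          lower (λ s → lower (G s) t) s ≡ lower (λ s → lower (H s) t) s * x
  south G H e s t = low (λ s → low (e s) t) s
  shift : ∀ k i j → shiftY g n k i j ≡ shiftY f n k i j * x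
  shift k i j = trans
    (sum-cong (degree n k i j) λ t _ → trans (cong (ι ((t ℕ.+ j) C j) *_) (e k i (t ℕ.+ j)))
      (solve 3 (λ c y x → c :* (y :* x) := x :* (c :* y)) refl (ι ((t ℕ.+ j) C j)) (f n k i (t ℕ.+ j)) x))
    (trans (sym (sum-*ˡ (degree n k i j) x _)) (Qₚ.*-comm x _))

genA≡tableauCount*invFact : ∀ n k i j → genA n k i j ≡ tableauCount n k i j * invFact n
genA≡tableauCount*invFact n k i j = trans (/!≡ι*invFact n (A i j n k)) (cong (λ t → ι t * invFact n) (A≡tableauSum n k i j))

-- The identity (n + 1)/(n + 1)! = 1/n! turns the recurrence of the counts into the differential
-- one.
genA-step : ∀ n k i j → ι (suc n) * genA (suc n) k i j ≡ step genA n k i j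
genA-step n k i j = begin
  ι (suc n) * genA (suc n) k i j
    ≡⟨ cong (ι (suc n) *_) (genA≡tableauCount*invFact (suc n) k i j) ⟩
  ι (suc n) * (tableauCount (suc n) k i j * invFact (suc n))
    ≡⟨ solve 3 (λ m a f → m :* (a :* f) := a :* (m :* f)) refl (ι (suc n)) (tableauCount (suc n) k i j) (invFact (suc n)) ⟩
  tableauCount (suc n) k i j * (ι (suc n) * invFact (suc n))
    ≡⟨ cong₂ _*_ (tableauCount-step n k i j) (invFact-suc n) ⟩
  step tableauCount n k i j * invFact n
    ≡⟨ step-* tableauCount genA n (invFact n) (genA≡tableauCount*invFact n) k i j ⟨
  step genA n k i j ∎
  where
  open ≡-Reasoning
  open ℚS

genA-atZ0 : ∀ k i j → genA 0 k i j ≡ oneP 0 k i j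
genA-atZ0 zero    zero    zero    = refl
genA-atZ0 zero    zero    (suc j) = refl
genA-atZ0 zero    (suc i) j       = refl
genA-atZ0 (suc k) i       j       = refl

theorem3p2 : (n k i j : ℕ) → genA n k i j ≡ rhsA n k i j
theorem3p2 = step-unique genA F (λ k i j → trans (genA-atZ0 k i j) (sym (F-atZ0 k i j))) genA-step F-step
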